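{- ($\mathtt{random}$ is conservative.) Let $\Gamma\vdash M,N:A$ be terms of $\mathrm{SCI}_{\mathtt{mk}}$ such that $M\cong_{\mathtt{mk}}N$. Then $M\cong_{\mathtt{mk},\mathtt{ran}}N$.
   Context: **The language SCI.** Types: $A::=\mathtt{nat}\mid\mathtt{comm}\mid\mathtt{var}\mid A\multimap A$ (the first three are the base types). Terms: $M::=n\mid M\odot M\mid\mathtt{skip}\mid M;M\mid M:=M\mid\,!M\mid\mathtt{while}\ M\ \mathtt{do}\ M\mid\mathtt{ifzero}\ M\ \mathtt{then}\ M\ \mathtt{else}\ M\mid x\mid\lambda x^A.M\mid MM\mid\mathtt{new}\ x\ \mathtt{in}\ M$, where $n\in\mathbb N$, $x$ is an identifier, and $\odot$ ranges over a fixed collection of arithmetic operations on $\mathbb N$ including $+$ and (truncated) $-$. Terms are taken up to $\alpha$-equivalence ($\lambda x$ and $\mathtt{new}\ x$ bind $x$). A context $\Gamma$ is a list $x_1:A_1,\dots,x_n:A_n$ with distinct identifiers. **Typing** (all judgments must be well-formed, so $\Gamma,\Delta$ have disjoint identifiers in the application rule): $x:A\vdash x:A$; if $\Gamma,x:A\vdash M:B$ then $\Gamma\vdash\lambda x^A.M:A\multimap B$; if $\Gamma\vdash M:A\multimap B$ and $\Delta\vdash N:A$ then $\Gamma,\Delta\vdash MN:B$; weakening (from $\Gamma\vdash M:B$ infer $\Gamma,x:A\vdash M:B$); exchange (permuting $\Gamma$); $\vdash n:\mathtt{nat}$; $\vdash\mathtt{skip}:\mathtt{comm}$; and, with the same $\Gamma$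 in all premises and conclusion: $M\odot N:\mathtt{nat}$ if $M,N:\mathtt{nat}$; $M;N:B$ if $M:\mathtt{comm}$, $N:B$, $B$ a base type; $M:=N:\mathtt{comm}$ if $M:\mathtt{var}$, $N:\mathtt{nat}$; $!M:\mathtt{nat}$ if $M:\mathtt{var}$; $\mathtt{while}\ M\ \mathtt{do}\ N:\mathtt{comm}$ if $M:\mathtt{nat}$, $N:\mathtt{comm}$; $\mathtt{ifzero}\ M\ \mathtt{then}\ N_1\ \mathtt{else}\ N_2:B$ if $M:\mathtt{nat}$, $N_1,N_2:B$, $B$ a base type; and $\Gamma\vdash\mathtt{new}\ x\ \mathtt{in}\ M:B$ if $\Gamma,x:\mathtt{var}\vdash M:B$ with $B\in\{\mathtt{comm},\mathtt{nat}\}$. **Operational semantics.** Judgments $\sigma,M\Downarrow\sigma',V$, where $M,V$ are typed in a context $\Gamma$ of $\mathtt{var}$-typed identifiers, $\sigma,\sigma'$ are stores (functions from the identifiers of $\Gamma$ to $\mathbb N$), and $V$ is a value: a numeral, $\mathtt{skip}$, an identifier, or a $\lambda$-abstraction. $(\sigma\mid x\mapsto n)$ is $\sigma$ updated/extended to send $x$ to $n$. Rules: $\sigma,V\Downarrow\sigma,V$; if $\sigma,M\Downarrow\sigma',\lambda x^A.M'$ and $\sigma',M'[N/x]\Downarrow\sigma'',V$ then $\sigma,MN\Downarrow\sigma'',V$; if $\sigma,M_1\Downarrow\sigma',n_1$ and $\sigma',M_2\Downarrow\sigma'',n_2$ then $\sigma,M_1\odot M_2\Downarrow\sigma'',n_1\odot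 n_2$; if $\sigma,N\Downarrow\sigma',n$ and $\sigma',M\Downarrow\sigma'',x$ then $\sigma,M:=N\Downarrow(\sigma''\mid x\mapsto n),\mathtt{skip}$; if $\sigma,M\Downarrow\sigma',x$ then $\sigma,!M\Downarrow\sigma',\sigma'(x)$; if $\sigma,M\Downarrow\sigma',\mathtt{skip}$ and $\sigma',N\Downarrow\sigma'',V$ then $\sigma,M;N\Downarrow\sigma'',V$; if $\sigma,M\Downarrow\sigma',n$ with $n\neq0$ then $\sigma,\mathtt{while}\ M\ \mathtt{do}\ N\Downarrow\sigma',\mathtt{skip}$; if $\sigma,M\Downarrow\sigma',0$, $\sigma',N\Downarrow\sigma'',\mathtt{skip}$ and $\sigma'',\mathtt{while}\ M\ \mathtt{do}\ N\Downarrow\sigma''',\mathtt{skip}$ then $\sigma,\mathtt{while}\ M\ \mathtt{do}\ N\Downarrow\sigma''',\mathtt{skip}$; $\mathtt{ifzero}$ evaluates its guard and then the first branch (guard value $0$) or the second (guard value $\neq0$), threading the store; if $(\sigma\mid x\mapsto0),M\Downarrow(\sigma'\mid x\mapsto n),V$ then $\sigma,\mathtt{new}\ x\ \mathtt{in}\ M\Downarrow\sigma',V$ (with $x$ not in the domain of $\sigma,\sigma'$). For closed terms the empty store is omitted. **Extensions.** $\mathrm{SCI}_{\mathtt{mk}}$ is SCI plus: $\Gamma\vdash\mathtt{mkvar}\ M\ N:\mathtt{var}$ if $\Gamma\vdash M:\mathtt{nat}\multimap\mathtt{comm}$ and $\Gamma\vdash N:\mathtt{nat}$; $\mathtt{mkvar}\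 M\ N$ is a value (evaluates to itself), and: if $\sigma,N\Downarrow\sigma',n$, $\sigma',M\Downarrow\sigma'',\mathtt{mkvar}\ M_1\ M_2$ and $\sigma'',M_1n\Downarrow\sigma''',V$ then $\sigma,M:=N\Downarrow\sigma''',V$; if $\sigma,M\Downarrow\sigma',\mathtt{mkvar}\ M_1\ M_2$ and $\sigma',M_2\Downarrow\sigma'',V$ then $\sigma,!M\Downarrow\sigma'',V$. $\mathrm{SCI}_{\mathtt{mk},\mathtt{ran}}$ is $\mathrm{SCI}_{\mathtt{mk}}$ plus a constant $\Gamma\vdash\mathtt{random}:\mathtt{nat}$ with $\sigma,\mathtt{random}\Downarrow\sigma,n$ for every $n\in\mathbb N$. **Contextual equivalence.** For $L\in\{\mathrm{SCI}_{\mathtt{mk}},\mathrm{SCI}_{\mathtt{mk},\mathtt{ran}}\}$ and terms $\Gamma\vdash M,N:A$ of $L$, $M$ and $N$ are contextually equivalent in $L$ iff for every context (term with a hole, possibly capturing) $C[-]$ of $L$ with $\vdash C[M],C[N]:B$, $B\in\{\mathtt{comm},\mathtt{nat}\}$, and every value $\vdash V:B$: $C[M]\Downarrow V\iff C[N]\Downarrow V$. This relation is written $\cong_{\mathtt{mk}}$ for $\mathrm{SCI}_{\mathtt{mk}}$ and $\cong_{\mathtt{mk},\mathtt{ran}}$ for $\mathrm{SCI}_{\mathtt{mk},\mathtt{ran}}$. -}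

module Defs where

open import Data.Fin using (Fin; zero; suc)
open import Data.Maybe using (Maybe; just; nothing)
open import Data.Nat using (ℕ; zero; suc; _+_; _∸_)
open import Data.Vec using (Vec; []; _∷_; lookup; replicate; _[_]≔_)
open import Function.Bundles using (_↣_; _⇔_; module Injection)
open import Relation.Binary.PropositionalEquality using (_≡_; _≢_)

record Arithmetic : Set₁ where
  field
    Op      : Set
    ⟦_⟧     : Op → ℕ → ℕ → ℕ
    plus    : Op
    ⟦plus⟧  : ∀ i j → ⟦ plus ⟧ i j ≡ i + j
    minus   : Op
    ⟦minus⟧ : ∀ i j → ⟦ minus ⟧ i j ≡ i ∸ j

infixr 7 _⊸_

data Ty : Set where
  nat comm var : Ty
  _⊸_          : Ty → Ty → Ty

data Base : Ty → Set where
  nat  : Base nat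
  comm : Base comm
  var  : Base var

data Ground : Ty → Set where
  nat  : Ground nat
  comm : Ground comm

data Lang : Set where
  mk    : Lang
  mkran : Lang

-- Identifiers in scope are the elements of Fin n (de Bruijn indices), so terms
-- are represented up to α-equivalence.  Typing contexts and stores are finite
-- partial maps on Fin n: an identifier may be in scope and yet not belong to
-- the typing context (or to the domain of the store).  Identifiers in a context
-- are thus automatically distinct, and exchange is built in.

PartialMap : Set → ℕ → Set
PartialMap A n = Vec (Maybe A) n

∅ : ∀ {A n} → PartialMap A n
∅ {n = n} = replicate n nothing

Cxt : ℕ → Set
Cxt = PartialMap Ty

Store : ℕ → Set
Store = PartialMap ℕ

-- Θ ≔ Γ ⊎ Δ says that Γ and Δ have disjoint domains and union Θ.
infix 4 _≔_⊎_

data _≔_⊎_ : ∀ {n} → Cxt n → Cxt n → Cxt n → Set where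
  []      : [] ≔ [] ⊎ []
  neither : ∀ {n} {Θ Γ Δ : Cxt n} → Θ ≔ Γ ⊎ Δ →
            (nothing ∷ Θ) ≔ (nothing ∷ Γ) ⊎ (nothing ∷ Δ)
  left    : ∀ {n} {Θ Γ Δ : Cxt n} {A} → Θ ≔ Γ ⊎ Δ →
            (just A ∷ Θ) ≔ (just A ∷ Γ) ⊎ (nothing ∷ Δ)
  right   : ∀ {n} {Θ Γ Δ : Cxt n} {A} → Θ ≔ Γ ⊎ Δ →
            (just A ∷ Θ) ≔ (nothing ∷ Γ) ⊎ (just A ∷ Δ)

module SCI (𝒜 : Arithmetic) where

  open Arithmetic 𝒜

  infixl 8 _·_
  infix  9 `_ !_
  infix  6 _:=_
  infixr 5 _⨾_

  -- Raw terms of the largest language; the language L of a term is recorded by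
  -- the typing judgement Γ ⊢[ L ] M ∶ A.
  data Term (n : ℕ) : Set where
    num                 : ℕ → Term n
    op                  : Op → Term n → Term n → Term n
    skip                : Term n
    _⨾_                 : Term n → Term n → Term n
    _:=_                : Term n → Term n → Term n
    !_                  : Term n → Term n
    while               : Term n → Term n → Term n
    ifzero              : Term n → Term n → Term n → Term n
    `_                  : Fin n → Term n
    ƛ                   : Ty → Term (suc n) → Term n
    _·_                 : Term n → Term n → Term n
    new                 : Term (suc n) → Term n
    mkvar               : Term n → Term n → Term n
    random              : Term n

  ext : ∀ {n m} → (Fin n → Fin m) → Fin (suc n) → Fin (suc m)
  ext ρ zero    = zero
  ext ρ (suc x) = suc (ρ x)

  rename : ∀ {n m} → (Fin n → Fin m) → Term n → Term m
  rename ρ (num i)                   = num i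
  rename ρ (op o M N)                = op o (rename ρ M) (rename ρ N)
  rename ρ skip                      = skip
  rename ρ (M ⨾ N)                   = rename ρ M ⨾ rename ρ N
  rename ρ (M := N)                  = rename ρ M := rename ρ N
  rename ρ (! M)                     = ! rename ρ M
  rename ρ (while M N)               = while (rename ρ M) (rename ρ N)
  rename ρ (ifzero M N₁ N₂)          = ifzero (rename ρ M) (rename ρ N₁) (rename ρ N₂)
  rename ρ (` x)                     = ` ρ x
  rename ρ (ƛ A M)                   = ƛ A (rename (ext ρ) M)
  rename ρ (M · N)                   = rename ρ M · rename ρ N
  rename ρ (new M)                   = new (rename (ext ρ) M)
  rename ρ (mkvar M N)               = mkvar (rename ρ M) (rename ρ N)
  rename ρ random                    = random

  weaken : ∀ {n} → Term n → Term (suc n)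
  weaken = rename suc

  exts : ∀ {n m} → (Fin n → Term m) → Fin (suc n) → Term (suc m)
  exts σ zero    = ` zero
  exts σ (suc x) = weaken (σ x)

  subst : ∀ {n m} → (Fin n → Term m) → Term n → Term m
  subst σ (num i)                   = num i
  subst σ (op o M N)                = op o (subst σ M) (subst σ N)
  subst σ skip                      = skip
  subst σ (M ⨾ N)                   = subst σ M ⨾ subst σ N
  subst σ (M := N)                  = subst σ M := subst σ N
  subst σ (! M)                     = ! subst σ M
  subst σ (while M N)               = while (subst σ M) (subst σ N)
  subst σ (ifzero M N₁ N₂)          = ifzero (subst σ M) (subst σ N₁) (subst σ N₂)
  subst σ (` x)                     = σ x
  subst σ (ƛ A M)                   = ƛ A (subst (exts σ) M)
  subst σ (M · N)                   = subst σ M · subst σ N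
  subst σ (new M)                   = new (subst (exts σ) M)
  subst σ (mkvar M N)               = mkvar (subst σ M) (subst σ N)
  subst σ random                    = random

  single : ∀ {n} → Term n → Fin (suc n) → Term n
  single N zero    = N
  single N (suc x) = ` x

  _[_] : ∀ {n} → Term (suc n) → Term n → Term n
  M [ N ] = subst (single N) M

  infix 4 _⊢[_]_∶_

  data _⊢[_]_∶_ {n : ℕ} : Cxt n → Lang → Term n → Ty → Set where
    ⊢var    : ∀ {L x A} → ∅ [ x ]≔ just A ⊢[ L ] ` x ∶ A
    ⊢lam    : ∀ {L Γ A B M} → just A ∷ Γ ⊢[ L ] M ∶ B → Γ ⊢[ L ] ƛ A M ∶ A ⊸ B
    ⊢app    : ∀ {L Θ Γ Δ A B M N} → Θ ≔ Γ ⊎ Δ →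
              Γ ⊢[ L ] M ∶ A ⊸ B → Δ ⊢[ L ] N ∶ A → Θ ⊢[ L ] M · N ∶ B
    ⊢weak   : ∀ {L Γ x A B M} → lookup Γ x ≡ nothing →
              Γ ⊢[ L ] M ∶ B → Γ [ x ]≔ just A ⊢[ L ] M ∶ B
    ⊢num    : ∀ {L i} → ∅ ⊢[ L ] num i ∶ nat
    ⊢skip   : ∀ {L} → ∅ ⊢[ L ] skip ∶ comm
    ⊢op     : ∀ {L Γ o M N} →
              Γ ⊢[ L ] M ∶ nat → Γ ⊢[ L ] N ∶ nat → Γ ⊢[ L ] op o M N ∶ nat
    ⊢seq    : ∀ {L Γ B M N} → Base B →
              Γ ⊢[ L ] M ∶ comm → Γ ⊢[ L ] N ∶ B → Γ ⊢[ L ] M ⨾ N ∶ B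
    ⊢assign : ∀ {L Γ M N} →
              Γ ⊢[ L ] M ∶ var → Γ ⊢[ L ] N ∶ nat → Γ ⊢[ L ] M := N ∶ comm
    ⊢deref  : ∀ {L Γ M} → Γ ⊢[ L ] M ∶ var → Γ ⊢[ L ] ! M ∶ nat
    ⊢while  : ∀ {L Γ M N} → Γ ⊢[ L ] M ∶ nat → Γ ⊢[ L ] N ∶ comm →
              Γ ⊢[ L ] while M N ∶ comm
    ⊢ifzero : ∀ {L Γ B M N₁ N₂} → Base B → Γ ⊢[ L ] M ∶ nat →
              Γ ⊢[ L ] N₁ ∶ B → Γ ⊢[ L ] N₂ ∶ B →
              Γ ⊢[ L ] ifzero M N₁ N₂ ∶ B
    ⊢new    : ∀ {L Γ B M} → Ground B →
              just var ∷ Γ ⊢[ L ] M ∶ B → Γ ⊢[ L ] new M ∶ B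
    ⊢mkvar  : ∀ {L Γ M N} → Γ ⊢[ L ] M ∶ nat ⊸ comm → Γ ⊢[ L ] N ∶ nat →
              Γ ⊢[ L ] mkvar M N ∶ var
    ⊢random : ∀ {Γ} → Γ ⊢[ mkran ] random ∶ nat

  data Value {n : ℕ} : Term n → Set where
    num   : ∀ {i} → Value (num i)
    skip  : Value skip
    ident : ∀ {x} → Value (` x)
    lam   : ∀ {A M} → Value (ƛ A M)
    mkvar : ∀ {M N} → Value (mkvar M N)

  infix 4 ⟨_,_⟩⇓⟨_,_⟩

  -- On terms typed in mk the rule for random is never used, so the restriction
  -- of this relation to them is the evaluation relation of that language.
  data ⟨_,_⟩⇓⟨_,_⟩ {n : ℕ} : Store n → Term n → Store n → Term n → Set where
    ⇓value    : ∀ {σ V} → Value V → ⟨ σ , V ⟩⇓⟨ σ , V ⟩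
    ⇓app      : ∀ {σ σ′ σ″ A M M′ N V} →
                ⟨ σ , M ⟩⇓⟨ σ′ , ƛ A M′ ⟩ → ⟨ σ′ , M′ [ N ] ⟩⇓⟨ σ″ , V ⟩ →
                ⟨ σ , M · N ⟩⇓⟨ σ″ , V ⟩
    ⇓op       : ∀ {σ σ′ σ″ o M₁ M₂ i j} →
                ⟨ σ , M₁ ⟩⇓⟨ σ′ , num i ⟩ → ⟨ σ′ , M₂ ⟩⇓⟨ σ″ , num j ⟩ →
                ⟨ σ , op o M₁ M₂ ⟩⇓⟨ σ″ , num (⟦ o ⟧ i j) ⟩
    ⇓assign   : ∀ {σ σ′ σ″ M N x i} →
                ⟨ σ , N ⟩⇓⟨ σ′ , num i ⟩ → ⟨ σ′ , M ⟩⇓⟨ σ″ , ` x ⟩ →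
                ⟨ σ , M := N ⟩⇓⟨ σ″ [ x ]≔ just i , skip ⟩
    ⇓deref    : ∀ {σ σ′ M x i} →
                ⟨ σ , M ⟩⇓⟨ σ′ , ` x ⟩ → lookup σ′ x ≡ just i →
                ⟨ σ , ! M ⟩⇓⟨ σ′ , num i ⟩
    ⇓seq      : ∀ {σ σ′ σ″ M N V} →
                ⟨ σ , M ⟩⇓⟨ σ′ , skip ⟩ → ⟨ σ′ , N ⟩⇓⟨ σ″ , V ⟩ →
                ⟨ σ , M ⨾ N ⟩⇓⟨ σ″ , V ⟩
    ⇓while-≢0 : ∀ {σ σ′ M N i} →
                ⟨ σ , M ⟩⇓⟨ σ′ , num i ⟩ → i ≢ 0 →
                ⟨ σ , while M N ⟩⇓⟨ σ′ , skip ⟩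
    ⇓while-0  : ∀ {σ σ′ σ″ σ‴ M N} →
                ⟨ σ , M ⟩⇓⟨ σ′ , num 0 ⟩ → ⟨ σ′ , N ⟩⇓⟨ σ″ , skip ⟩ →
                ⟨ σ″ , while M N ⟩⇓⟨ σ‴ , skip ⟩ →
                ⟨ σ , while M N ⟩⇓⟨ σ‴ , skip ⟩
    ⇓ifzero-0 : ∀ {σ σ′ σ″ M N₁ N₂ V} →
                ⟨ σ , M ⟩⇓⟨ σ′ , num 0 ⟩ → ⟨ σ′ , N₁ ⟩⇓⟨ σ″ , V ⟩ →
                ⟨ σ , ifzero M N₁ N₂ ⟩⇓⟨ σ″ , V ⟩
    ⇓ifzero-≢0 : ∀ {σ σ′ σ″ M N₁ N₂ V i} →
                ⟨ σ , M ⟩⇓⟨ σ′ , num i ⟩ → i ≢ 0 → ⟨ σ′ , N₂ ⟩⇓⟨ σ″ , V ⟩ →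
                ⟨ σ , ifzero M N₁ N₂ ⟩⇓⟨ σ″ , V ⟩
    ⇓new      : ∀ {σ σ′ M V i} →
                ⟨ just 0 ∷ σ , M ⟩⇓⟨ just i ∷ σ′ , weaken V ⟩ →
                ⟨ σ , new M ⟩⇓⟨ σ′ , V ⟩
    ⇓assign-mkvar : ∀ {σ σ′ σ″ σ‴ M N M₁ M₂ V i} →
                ⟨ σ , N ⟩⇓⟨ σ′ , num i ⟩ → ⟨ σ′ , M ⟩⇓⟨ σ″ , mkvar M₁ M₂ ⟩ →
                ⟨ σ″ , M₁ · num i ⟩⇓⟨ σ‴ , V ⟩ →
                ⟨ σ , M := N ⟩⇓⟨ σ‴ , V ⟩
    ⇓deref-mkvar : ∀ {σ σ′ σ″ M M₁ M₂ V} →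
                ⟨ σ , M ⟩⇓⟨ σ′ , mkvar M₁ M₂ ⟩ → ⟨ σ′ , M₂ ⟩⇓⟨ σ″ , V ⟩ →
                ⟨ σ , ! M ⟩⇓⟨ σ″ , V ⟩
    ⇓random   : ∀ {σ} i → ⟨ σ , random ⟩⇓⟨ σ , num i ⟩

  infix 4 _⇓_

  _⇓_ : ∀ {n} → Term n → Term n → Set
  M ⇓ V = ⟨ ∅ , M ⟩⇓⟨ ∅ , V ⟩

  -- Context n m: one-hole contexts with free identifiers in Fin m, whose hole
  -- receives a term with identifiers in Fin n.  Textual, capturing replacement
  -- sends each identifier of the plugged term to the innermost binder bearing
  -- its name, or leaves it free if there is none; distinct identifiers have
  -- distinct destinations.  The injection at the hole records the destinations.
  data Context (n : ℕ) : ℕ → Set where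
    hole    : ∀ {m} → Fin n ↣ Fin m → Context n m
    op₁     : ∀ {m} → Op → Context n m → Term m → Context n m
    op₂     : ∀ {m} → Op → Term m → Context n m → Context n m
    seq₁    : ∀ {m} → Context n m → Term m → Context n m
    seq₂    : ∀ {m} → Term m → Context n m → Context n m
    assign₁ : ∀ {m} → Context n m → Term m → Context n m
    assign₂ : ∀ {m} → Term m → Context n m → Context n m
    deref   : ∀ {m} → Context n m → Context n m
    while₁  : ∀ {m} → Context n m → Term m → Context n m
    while₂  : ∀ {m} → Term m → Context n m → Context n m
    ifzero₁ : ∀ {m} → Context n m → Term m → Term m → Context n m
    ifzero₂ : ∀ {m} → Term m → Context n m → Term m → Context n m
    ifzero₃ : ∀ {m} → Term m → Term m → Context n m → Context n m
    lam     : ∀ {m} → Ty → Context n (suc m) → Context n m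
    app₁    : ∀ {m} → Context n m → Term m → Context n m
    app₂    : ∀ {m} → Term m → Context n m → Context n m
    new     : ∀ {m} → Context n (suc m) → Context n m
    mkvar₁  : ∀ {m} → Context n m → Term m → Context n m
    mkvar₂  : ∀ {m} → Term m → Context n m → Context n m

  plug : ∀ {n m} → Context n m → Term n → Term m
  plug (hole ρ)          M = rename (Injection.to ρ) M
  plug (op₁ o C N)       M = op o (plug C M) N
  plug (op₂ o N C)       M = op o N (plug C M)
  plug (seq₁ C N)        M = plug C M ⨾ N
  plug (seq₂ N C)        M = N ⨾ plug C M
  plug (assign₁ C N)     M = plug C M := N
  plug (assign₂ N C)     M = N := plug C M
  plug (deref C)         M = ! plug C M
  plug (while₁ C N)      M = while (plug C M) N
  plug (while₂ N C)      M = while N (plug C M)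
  plug (ifzero₁ C N₁ N₂) M = ifzero (plug C M) N₁ N₂
  plug (ifzero₂ N₀ C N₂) M = ifzero N₀ (plug C M) N₂
  plug (ifzero₃ N₀ N₁ C) M = ifzero N₀ N₁ (plug C M)
  plug (lam A C)         M = ƛ A (plug C M)
  plug (app₁ C N)        M = plug C M · N
  plug (app₂ N C)        M = N · plug C M
  plug (new C)           M = new (plug C M)
  plug (mkvar₁ C N)      M = mkvar (plug C M) N
  plug (mkvar₂ N C)      M = mkvar N (plug C M)

  infix 4 _≅[_]_

  -- Typability of C[M] in L forces C to be a context of L.  The scope Fin m of
  -- C[M] is arbitrary, while C[M] is closed, i.e. typed in the empty context:
  -- this allows contexts that leave some identifiers of M and N uncaptured,
  -- provided these do not occur free in either term.
  _≅[_]_ : ∀ {n} → Term n → Lang → Term n → Set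
  _≅[_]_ {n} M L N =
    ∀ {m} (C : Context n m) {B} → Ground B →
    ∅ ⊢[ L ] plug C M ∶ B → ∅ ⊢[ L ] plug C N ∶ B →
    ∀ {V} → Value V → ∅ ⊢[ L ] V ∶ B →
    plug C M ⇓ V ⇔ plug C N ⇓ V

-- Occurrences of random in a context C are eliminated one at a time.  Replace one
-- of them by a term that reads its outcomes from a sequence encoded by the initial
-- content r of a new variable x, giving a context C_r.  A terminating evaluation of
-- C[M] uses finitely many outcomes, so it is matched by one of C_r[M] for a suitable
-- r; conversely, whatever C_r[N] reads from x could have been produced by random.
-- Only one occurrence is replaced, so x is used in one place and C_r[M] respects
-- the affine typing rule for application.  Reduction may copy the occurrence, and
-- all the copies then share x.

module Submission where

open import Data.Fin using (Fin; zero; suc; punchIn; punchOut)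
open import Data.Fin.Properties using (punchIn-injective; punchInᵢ≢i; punchIn-punchOut; suc-injective; _≟_)
open import Data.Maybe using (Maybe; just; nothing)
open import Data.Nat using (ℕ; zero; suc; _+_; _∸_; _≤_; z≤n; s≤s)
open import Data.Nat.Properties
  using (+-suc; +-identityʳ; m≤n⇒m∸n≡0; m>n⇒m∸n≢0; m≤m+n; m+n∸m≡n; m+n∸n≡m; 0∸n≡0;
         m+n≡0⇒m≡0; m+n≡0⇒n≡0; m∸n≤m; ≤-trans; ≤-refl)
open import Data.Product using (∃; ∃₂; _×_; _,_)
open import Data.Sum using (_⊎_; inj₁; inj₂)
open import Data.Vec using (Vec; []; _∷_; lookup; _[_]≔_; insertAt)
open import Data.Vec.Properties using (insertAt-lookup; insertAt-punchIn; lookup-replicate; lookup∘update)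
open import Function.Bundles using (mk⇔; mk↣; module Equivalence; module Injection)
open import Function.Construct.Composition using (_↣-∘_)
open import Function.Construct.Symmetry using (⇔-sym)
open import Relation.Binary.PropositionalEquality
  using (_≡_; refl; sym; trans; cong; cong₂; module ≡-Reasoning)
  renaming (subst to transport)
open import Relation.Nullary using (yes; no; contradiction)

open import Defs

-- A suitable `r` depends on the evaluation at hand, so `C` and `C_r` are not interchangeable: an
-- evaluation of `C[M]` is matched for some `r`, while evaluations of `C_r[N]` are matched for every
-- `r`. Hence a single evaluation is transferred from `M` to `N` in one direction, the same `r`
-- serving both terms, and the converse follows by symmetry. This is enough because contextual
-- equivalence only compares which values can be reached. The other occurrences of `random` stay in
-- `C_r`, so the simulation allows `random` on both sides; the equivalence in `mk` is invoked only
-- once none are left. The encoding of sequences is limited by the arithmetic: only addition and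
-- truncated subtraction are assumed. Cantor's pairing can be inverted with these and a loop, since
-- subtracting 1, 2, 3, ... finds the diagonal on which a number lies.

insertAt-update : ∀ {A : Set} {n} (xs : Vec A n) x {v w} →
                  insertAt xs x v [ x ]≔ w ≡ insertAt xs x w
insertAt-update xs       zero    = refl
insertAt-update (_ ∷ xs) (suc x) = cong (_ ∷_) (insertAt-update xs x)

insertAt-punchIn-update : ∀ {A : Set} {n} (xs : Vec A n) x y {v w} →
                          insertAt xs x v [ punchIn x y ]≔ w ≡ insertAt (xs [ y ]≔ w) x v
insertAt-punchIn-update xs       zero    y       = refl
insertAt-punchIn-update (_ ∷ xs) (suc x) zero    = refl
insertAt-punchIn-update (_ ∷ xs) (suc x) (suc y) = cong (_ ∷_) (insertAt-punchIn-update xs x y)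

insertAt-∅ : ∀ {A n} (x : Fin (suc n)) → insertAt (∅ {A} {n}) x nothing ≡ ∅
insertAt-∅             zero    = refl
insertAt-∅ {n = suc _} (suc x) = cong (nothing ∷_) (insertAt-∅ x)

module Derandomization (𝒜 : Arithmetic) where

  open Arithmetic 𝒜
  open SCI 𝒜

  -- Drawing from a variable

  ⇓num : ∀ {n} {σ τ : Store n} {M i j} → i ≡ j → ⟨ σ , M ⟩⇓⟨ τ , num i ⟩ → ⟨ σ , M ⟩⇓⟨ τ , num j ⟩
  ⇓num refl d = d

  ⇓plus : ∀ {n} {σ σ′ σ″ : Store n} {M N i j} →
          ⟨ σ , M ⟩⇓⟨ σ′ , num i ⟩ → ⟨ σ′ , N ⟩⇓⟨ σ″ , num j ⟩ →
          ⟨ σ , op plus M N ⟩⇓⟨ σ″ , num (i + j) ⟩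
  ⇓plus d e = ⇓num (⟦plus⟧ _ _) (⇓op d e)

  ⇓minus : ∀ {n} {σ σ′ σ″ : Store n} {M N i j} →
           ⟨ σ , M ⟩⇓⟨ σ′ , num i ⟩ → ⟨ σ′ , N ⟩⇓⟨ σ″ , num j ⟩ →
           ⟨ σ , op minus M N ⟩⇓⟨ σ″ , num (i ∸ j) ⟩
  ⇓minus d e = ⇓num (⟦minus⟧ _ _) (⇓op d e)

  ⇓! : ∀ {n} {σ : Store n} {x i} → lookup σ x ≡ just i → ⟨ σ , ! ` x ⟩⇓⟨ σ , num i ⟩
  ⇓! = ⇓deref (⇓value ident)

  -- The variable x holds a number r encoding a finite sequence of outcomes: if
  -- r = (1 + ⋯ + m) + i with i ≤ m, then i is the next outcome and m ∸ i encodes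
  -- the others.  The loop subtracts 1, 2, …, m in turn, the local variable k
  -- recording how far it got.
  drawLoop : ∀ {n} → Fin n → Fin n → Term n
  drawLoop k x =
    while (op minus (op plus (num 1) (! ` k)) (! ` x))
          (` k := op plus (num 1) (! ` k) ⨾ ` x := op minus (! ` x) (! ` k))

  draw : ∀ {n} → Fin n → Term n
  draw x =
    new (drawLoop zero (suc x) ⨾
         ` suc x := op minus (! ` zero) (! ` suc x) ⨾
         ` zero := op minus (! ` zero) (! ` suc x) ⨾
         ! ` zero)

  module _ {n} (σ : Store n) (x : Fin (suc n)) where

    store : ℕ → ℕ → Store (suc (suc n))
    store k r = just k ∷ insertAt σ x (just r)

    lookup-x : ∀ {r} → lookup (insertAt σ x (just r)) x ≡ just r
    lookup-x = insertAt-lookup σ x _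

    ⇓assign-x : ∀ {k r i M} → ⟨ store k r , M ⟩⇓⟨ store k r , num i ⟩ →
                ⟨ store k r , ` suc x := M ⟩⇓⟨ store k i , skip ⟩
    ⇓assign-x {k} {r} {i} d =
      transport (λ ς → ⟨ store k r , _ ⟩⇓⟨ just k ∷ ς , skip ⟩) (insertAt-update σ x)
        (⇓assign d (⇓value ident))

    -- The number (k + 1) + ⋯ + (k + d) + i, held by the variable when 1, ..., k have been
    -- subtracted and d subtractions remain. For `k = 0` and `d = i + r` it is Cantor's pairing of
    -- `i` and `r`.
    code : ℕ → ℕ → ℕ → ℕ
    code zero    k i = i
    code (suc d) k i = suc k + code d (suc k) i

    -- A loop of this language runs as long as its guard is 0, so the guard `suc k ∸ x` asks whether
    -- `suc k` can still be subtracted. At `k = m` the bound `i ≤ m` makes it nonzero.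
    ⇓drawLoop : ∀ d k i {m} → d + k ≡ m → i ≤ m →
                ⟨ store k (code d k i) , drawLoop zero (suc x) ⟩⇓⟨ store m i , skip ⟩
    ⇓drawLoop zero k i refl i≤k =
      ⇓while-≢0 (⇓minus (⇓plus (⇓value num) (⇓! refl)) (⇓! lookup-x)) (m>n⇒m∸n≢0 (s≤s i≤k))
    ⇓drawLoop (suc d) k i d+k≡m i≤m =
      ⇓while-0
        (⇓num (m≤n⇒m∸n≡0 (m≤m+n (suc k) r)) (⇓minus (⇓plus (⇓value num) (⇓! refl)) (⇓! lookup-x)))
        (⇓seq (⇓assign (⇓plus (⇓value num) (⇓! refl)) (⇓value ident))
              (⇓assign-x (⇓num (m+n∸m≡n (suc k) r) (⇓minus (⇓! lookup-x) (⇓! refl)))))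
        (⇓drawLoop d (suc k) i (trans (+-suc d k) d+k≡m) i≤m)
      where r = code d (suc k) i

    ⇓draw : ∀ i r → ∃ λ r₀ → ⟨ insertAt σ x (just r₀) , draw x ⟩⇓⟨ insertAt σ x (just r) , num i ⟩
    -- On the diagonal `m = i + r` the loop ends with `k` holding `i + r` and `x` holding `i`. Two
    -- subtractions, `(i + r) ∸ i` and then `(i + r) ∸ r`, leave the remaining sequence `r` in `x`
    -- and the outcome `i` in `k`.
    ⇓draw i r = code (i + r) 0 i ,
      ⇓new (⇓seq (⇓drawLoop (i + r) 0 i (+-identityʳ (i + r)) (m≤m+n i r))
           (⇓seq (⇓assign-x (⇓num (m+n∸m≡n i r) (⇓minus (⇓! refl) (⇓! lookup-x))))
           (⇓seq (⇓assign (⇓num (m+n∸n≡m i r) (⇓minus (⇓! refl) (⇓! lookup-x))) (⇓value ident))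
                 (⇓! refl))))

  -- What an evaluation of `draw` can change and return

  data Expr {n} : Term n → Set where
    num   : ∀ {i} → Expr (num i)
    deref : ∀ {x} → Expr (! ` x)
    op    : ∀ {o M N} → Expr M → Expr N → Expr (op o M N)

  Expr-store : ∀ {n} {σ τ : Store n} {M V} → Expr M → ⟨ σ , M ⟩⇓⟨ τ , V ⟩ → τ ≡ σ
  Expr-store num      (⇓value _)           = refl
  Expr-store deref    (⇓deref (⇓value _) _) = refl
  Expr-store (op d e) (⇓op ⇓M ⇓N)          = trans (Expr-store e ⇓N) (Expr-store d ⇓M)

  module _ {n} (σ : Store n) (x : Fin (suc n)) where

    Reachable : Store (suc (suc n)) → Set
    Reachable τ = ∃₂ λ k r → τ ≡ store σ x k r

    assign-k : ∀ {k r M τ V} → Expr M → ⟨ store σ x k r , ` zero := M ⟩⇓⟨ τ , V ⟩ → Reachable τ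
    assign-k e (⇓assign ⇓M (⇓value _)) with refl ← Expr-store e ⇓M = _ , _ , refl

    assign-x : ∀ {k r M τ V} → Expr M → ⟨ store σ x k r , ` suc x := M ⟩⇓⟨ τ , V ⟩ → Reachable τ
    assign-x e (⇓assign ⇓M (⇓value _)) with refl ← Expr-store e ⇓M =
      _ , _ , cong (_ ∷_) (insertAt-update σ x)

    drawLoop-store : ∀ {k r τ V} → ⟨ store σ x k r , drawLoop zero (suc x) ⟩⇓⟨ τ , V ⟩ → Reachable τ
    drawLoop-store (⇓while-≢0 ⇓M _) with refl ← Expr-store (op (op num deref) deref) ⇓M =
      _ , _ , refl
    drawLoop-store (⇓while-0 ⇓M (⇓seq ⇓k ⇓x) ⇓loop)
      with refl ← Expr-store (op (op num deref) deref) ⇓M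
      with _ , _ , refl ← assign-k (op num deref) ⇓k
      with _ , _ , refl ← assign-x (op deref deref) ⇓x = drawLoop-store ⇓loop

    -- The body of `draw` enters through an equation, which spares writing it out again. `V` is
    -- arbitrary so that it can be the weakened result occurring in `⇓new`.
    draw-body : ∀ {k r τ V M} → new M ≡ draw x → ⟨ store σ x k r , M ⟩⇓⟨ τ , V ⟩ →
                Reachable τ × ∃ λ i → V ≡ num i
    draw-body refl (⇓seq ⇓loop (⇓seq ⇓x (⇓seq ⇓k (⇓deref (⇓value _) _))))
      with _ , _ , refl ← drawLoop-store ⇓loop
      with _ , _ , refl ← assign-x (op deref deref) ⇓x
      with reachable ← assign-k (op deref deref) ⇓k = reachable , _ , refl

    -- Which number is drawn does not matter, since `random` can return any; so no decoding is
    -- involved, and every initial content is covered.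
    draw-inversion : ∀ {r τ V} → ⟨ insertAt σ x (just r) , draw x ⟩⇓⟨ τ , V ⟩ →
                     ∃₂ λ r′ i → τ ≡ insertAt σ x (just r′) × V ≡ num i
    draw-inversion {V = V} (⇓new ⇓M) with draw-body refl ⇓M
    draw-inversion {V = num i} (⇓new ⇓M) | (_ , r′ , refl) , _ = r′ , i , refl , refl

  -- Simulation

  infix 4 _~[_]_

  -- The right-hand term has `x` inserted into its scope and uses it only inside draws. Each
  -- `random` may independently be kept or drawn: reduction copies the marked occurrence and leaves
  -- others unmarked, and this freedom makes the relation stable under substitution. The position
  -- `x` varies because it shifts under binders.
  data _~[_]_ {n} : Term n → Fin (suc n) → Term (suc n) → Set where
    num    : ∀ {x i} → num i ~[ x ] num i
    op     : ∀ {x o M N M′ N′} → M ~[ x ] M′ → N ~[ x ] N′ → op o M N ~[ x ] op o M′ N′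
    skip   : ∀ {x} → skip ~[ x ] skip
    _⨾_    : ∀ {x M N M′ N′} → M ~[ x ] M′ → N ~[ x ] N′ → M ⨾ N ~[ x ] M′ ⨾ N′
    _:=_   : ∀ {x M N M′ N′} → M ~[ x ] M′ → N ~[ x ] N′ → (M := N) ~[ x ] (M′ := N′)
    !_     : ∀ {x M M′} → M ~[ x ] M′ → ! M ~[ x ] ! M′
    while  : ∀ {x M N M′ N′} → M ~[ x ] M′ → N ~[ x ] N′ → while M N ~[ x ] while M′ N′
    ifzero : ∀ {x M N₁ N₂ M′ N₁′ N₂′} → M ~[ x ] M′ → N₁ ~[ x ] N₁′ → N₂ ~[ x ] N₂′ →
             ifzero M N₁ N₂ ~[ x ] ifzero M′ N₁′ N₂′
    ident  : ∀ {x} y → ` y ~[ x ] ` punchIn x y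
    ƛ      : ∀ {x A M M′} → M ~[ suc x ] M′ → ƛ A M ~[ x ] ƛ A M′
    _·_    : ∀ {x M N M′ N′} → M ~[ x ] M′ → N ~[ x ] N′ → M · N ~[ x ] M′ · N′
    new    : ∀ {x M M′} → M ~[ suc x ] M′ → new M ~[ x ] new M′
    mkvar  : ∀ {x M N M′ N′} → M ~[ x ] M′ → N ~[ x ] N′ → mkvar M N ~[ x ] mkvar M′ N′
    random : ∀ {x} → random ~[ x ] random
    -- The equation keeps the body of draw out of the unifier.
    drawn  : ∀ {x D} → D ≡ draw x → random ~[ x ] D

  -- Renaming and substitution in simulated terms

  record Square {n m} (x : Fin (suc n)) (y : Fin (suc m))
                (ρ : Fin n → Fin m) (ρ′ : Fin (suc n) → Fin (suc m)) : Set where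
    field
      commute   : ∀ z → ρ′ (punchIn x z) ≡ punchIn y (ρ z)
      point     : ρ′ x ≡ y
      injective : ∀ {z w} → ρ′ z ≡ ρ′ w → z ≡ w

  open Square

  ext-injective : ∀ {n m} {ρ : Fin n → Fin m} → (∀ {z w} → ρ z ≡ ρ w → z ≡ w) →
                  ∀ {z w} → ext ρ z ≡ ext ρ w → z ≡ w
  ext-injective inj {zero}  {zero}  _ = refl
  ext-injective inj {suc _} {suc _} e = cong suc (inj (suc-injective e))

  ext-square : ∀ {n m x y} {ρ : Fin n → Fin m} {ρ′} → Square x y ρ ρ′ →
               Square (suc x) (suc y) (ext ρ) (ext ρ′)
  ext-square □ .commute zero    = refl
  ext-square □ .commute (suc z) = cong suc (□ .commute z)
  ext-square □ .point           = cong suc (□ .point)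
  ext-square □ .injective       = ext-injective (□ .injective)

  suc-square : ∀ {n} {x : Fin (suc n)} → Square x (suc x) suc suc
  suc-square .commute _ = refl
  suc-square .point     = refl
  suc-square .injective = suc-injective

  ~-rename : ∀ {n m x y} {ρ : Fin n → Fin m} {ρ′} → Square x y ρ ρ′ →
             ∀ {M M′} → M ~[ x ] M′ → rename ρ M ~[ y ] rename ρ′ M′
  ~-rename □ num            = num
  ~-rename □ (op M N)       = op (~-rename □ M) (~-rename □ N)
  ~-rename □ skip           = skip
  ~-rename □ (M ⨾ N)        = ~-rename □ M ⨾ ~-rename □ N
  ~-rename □ (M := N)       = ~-rename □ M := ~-rename □ N
  ~-rename □ (! M)          = ! ~-rename □ M
  ~-rename □ (while M N)    = while (~-rename □ M) (~-rename □ N)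
  ~-rename □ (ifzero L M N) = ifzero (~-rename □ L) (~-rename □ M) (~-rename □ N)
  ~-rename □ (ident z)      = transport (λ w → _ ~[ _ ] ` w) (sym (□ .commute z)) (ident _)
  ~-rename □ (ƛ M)          = ƛ (~-rename (ext-square □) M)
  ~-rename □ (M · N)        = ~-rename □ M · ~-rename □ N
  ~-rename □ (new M)        = new (~-rename (ext-square □) M)
  ~-rename □ (mkvar M N)    = mkvar (~-rename □ M) (~-rename □ N)
  ~-rename □ random         = random
  ~-rename □ (drawn refl)   = drawn (cong draw (□ .point))

  record Subst~ {n m} (x : Fin (suc n)) (y : Fin (suc m))
                (τ : Fin n → Term m) (τ′ : Fin (suc n) → Term (suc m)) : Set where
    field
      related : ∀ z → τ z ~[ y ] τ′ (punchIn x z)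
      point   : τ′ x ≡ ` y

  open Subst~

  exts-~ : ∀ {n m x y} {τ : Fin n → Term m} {τ′} → Subst~ x y τ τ′ →
           Subst~ (suc x) (suc y) (exts τ) (exts τ′)
  exts-~ s .related zero    = ident zero
  exts-~ s .related (suc z) = ~-rename suc-square (s .related z)
  exts-~ s .point           = cong weaken (s .point)

  subst-draw : ∀ {n m} {τ : Fin n → Term m} {x y} → τ x ≡ ` y → subst τ (draw x) ≡ draw y
  subst-draw e rewrite e = refl

  ~-subst : ∀ {n m x y} {τ : Fin n → Term m} {τ′} → Subst~ x y τ τ′ →
            ∀ {M M′} → M ~[ x ] M′ → subst τ M ~[ y ] subst τ′ M′
  ~-subst s num            = num
  ~-subst s (op M N)       = op (~-subst s M) (~-subst s N)
  ~-subst s skip           = skip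
  ~-subst s (M ⨾ N)        = ~-subst s M ⨾ ~-subst s N
  ~-subst s (M := N)       = ~-subst s M := ~-subst s N
  ~-subst s (! M)          = ! ~-subst s M
  ~-subst s (while M N)    = while (~-subst s M) (~-subst s N)
  ~-subst s (ifzero L M N) = ifzero (~-subst s L) (~-subst s M) (~-subst s N)
  ~-subst s (ident z)      = s .related z
  ~-subst s (ƛ M)          = ƛ (~-subst (exts-~ s) M)
  ~-subst s (M · N)        = ~-subst s M · ~-subst s N
  ~-subst s (new M)        = new (~-subst (exts-~ s) M)
  ~-subst s (mkvar M N)    = mkvar (~-subst s M) (~-subst s N)
  ~-subst s random         = random
  ~-subst {τ′ = τ′} s (drawn refl) = drawn (subst-draw {τ = τ′} (s .point))

  ~-[] : ∀ {n} {x : Fin (suc n)} {M M′ N N′} → M ~[ suc x ] M′ → N ~[ x ] N′ →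
         M [ N ] ~[ x ] M′ [ N′ ]
  ~-[] {x = x} {N = N} {N′} M~M′ N~N′ = ~-subst s M~M′
    where
    s : Subst~ (suc x) x (single N) (single N′)
    s .related zero    = N~N′
    s .related (suc z) = ident z
    s .point           = refl

  -- Serves to recognise a draw underneath a renaming. The local `split` functions take equations
  -- between arbitrary subterms, because unification gets stuck on applications of `rename`.
  rename-injective : ∀ {n m} {ρ : Fin n → Fin m} → (∀ {z w} → ρ z ≡ ρ w → z ≡ w) →
                     ∀ M N → rename ρ M ≡ rename ρ N → M ≡ N
  rename-injective inj (num i) (num .i) refl = refl
  rename-injective inj (op o M N) (op o′ M′ N′) e with split e
    where
    split : ∀ {n o o′} {M N M′ N′ : Term n} → op o M N ≡ op o′ M′ N′ → o ≡ o′ × M ≡ M′ × N ≡ N′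
    split refl = refl , refl , refl
  ... | refl , e₁ , e₂ = cong₂ (op o) (rename-injective inj M M′ e₁) (rename-injective inj N N′ e₂)
  rename-injective inj skip skip e = refl
  rename-injective inj (M ⨾ N) (M′ ⨾ N′) e with split e
    where
    split : ∀ {n} {M N M′ N′ : Term n} → M ⨾ N ≡ M′ ⨾ N′ → M ≡ M′ × N ≡ N′
    split refl = refl , refl
  ... | e₁ , e₂ = cong₂ _⨾_ (rename-injective inj M M′ e₁) (rename-injective inj N N′ e₂)
  rename-injective inj (M := N) (M′ := N′) e with split e
    where
    split : ∀ {n} {M N M′ N′ : Term n} → (M := N) ≡ (M′ := N′) → M ≡ M′ × N ≡ N′
    split refl = refl , refl
  ... | e₁ , e₂ = cong₂ _:=_ (rename-injective inj M M′ e₁) (rename-injective inj N N′ e₂)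
  rename-injective inj (! M) (! M′) e with split e
    where
    split : ∀ {n} {M M′ : Term n} → ! M ≡ ! M′ → M ≡ M′
    split refl = refl
  ... | e₁ = cong !_ (rename-injective inj M M′ e₁)
  rename-injective inj (while M N) (while M′ N′) e with split e
    where
    split : ∀ {n} {M N M′ N′ : Term n} → while M N ≡ while M′ N′ → M ≡ M′ × N ≡ N′
    split refl = refl , refl
  ... | e₁ , e₂ = cong₂ while (rename-injective inj M M′ e₁) (rename-injective inj N N′ e₂)
  rename-injective inj (ifzero L M N) (ifzero L′ M′ N′) e with split e
    where
    split : ∀ {n} {L M N L′ M′ N′ : Term n} → ifzero L M N ≡ ifzero L′ M′ N′ →
            L ≡ L′ × M ≡ M′ × N ≡ N′
    split refl = refl , refl , refl
  ... | e₁ , e₂ , e₃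
    with refl ← rename-injective inj L L′ e₁
       | refl ← rename-injective inj M M′ e₂
       | refl ← rename-injective inj N N′ e₃ = refl
  rename-injective inj (` x) (` y) e with split e
    where
    split : ∀ {n} {x y : Fin n} → ` x ≡ ` y → x ≡ y
    split refl = refl
  ... | e₁ = cong `_ (inj e₁)
  rename-injective inj (ƛ A M) (ƛ A′ M′) e with split e
    where
    split : ∀ {n A A′} {M M′ : Term (suc n)} → ƛ A M ≡ ƛ A′ M′ → A ≡ A′ × M ≡ M′
    split refl = refl , refl
  ... | refl , e₁ = cong (ƛ A) (rename-injective (ext-injective inj) M M′ e₁)
  rename-injective inj (M · N) (M′ · N′) e with split e
    where
    split : ∀ {n} {M N M′ N′ : Term n} → M · N ≡ M′ · N′ → M ≡ M′ × N ≡ N′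
    split refl = refl , refl
  ... | e₁ , e₂ = cong₂ _·_ (rename-injective inj M M′ e₁) (rename-injective inj N N′ e₂)
  rename-injective inj (new M) (new M′) e with split e
    where
    split : ∀ {n} {M M′ : Term (suc n)} → new M ≡ new M′ → M ≡ M′
    split refl = refl
  ... | e₁ = cong new (rename-injective (ext-injective inj) M M′ e₁)
  rename-injective inj (mkvar M N) (mkvar M′ N′) e with split e
    where
    split : ∀ {n} {M N M′ N′ : Term n} → mkvar M N ≡ mkvar M′ N′ → M ≡ M′ × N ≡ N′
    split refl = refl , refl
  ... | e₁ , e₂ = cong₂ mkvar (rename-injective inj M M′ e₁) (rename-injective inj N N′ e₂)
  rename-injective inj random random e = refl

  -- The rule `⇓new` requires a result of the form `weaken V`, so a simulating result must also
  -- avoid the local variable. It does: draws from `y` are renamings of draws from `x`, because `ρ′`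
  -- sends `x` to `y`.
  ~-renameˡ : ∀ {n m x y} {ρ : Fin n → Fin m} {ρ′} → Square x y ρ ρ′ →
              ∀ M {Q} → rename ρ M ~[ y ] Q → ∃ λ M′ → Q ≡ rename ρ′ M′ × M ~[ x ] M′
  ~-renameˡ □ (num i) num = _ , refl , num
  ~-renameˡ □ (op o M N) (op p q)
    with _ , refl , p′ ← ~-renameˡ □ M p | _ , refl , q′ ← ~-renameˡ □ N q = _ , refl , op p′ q′
  ~-renameˡ □ skip skip = _ , refl , skip
  ~-renameˡ □ (M ⨾ N) (p ⨾ q)
    with _ , refl , p′ ← ~-renameˡ □ M p | _ , refl , q′ ← ~-renameˡ □ N q = _ , refl , p′ ⨾ q′
  ~-renameˡ □ (M := N) (p := q)
    with _ , refl , p′ ← ~-renameˡ □ M p | _ , refl , q′ ← ~-renameˡ □ N q = _ , refl , p′ := q′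
  ~-renameˡ □ (! M) (! p)
    with _ , refl , p′ ← ~-renameˡ □ M p = _ , refl , ! p′
  ~-renameˡ □ (while M N) (while p q)
    with _ , refl , p′ ← ~-renameˡ □ M p | _ , refl , q′ ← ~-renameˡ □ N q = _ , refl , while p′ q′
  ~-renameˡ □ (ifzero L M N) (ifzero o p q)
    with _ , refl , o′ ← ~-renameˡ □ L o
       | _ , refl , p′ ← ~-renameˡ □ M p | _ , refl , q′ ← ~-renameˡ □ N q = _ , refl , ifzero o′ p′ q′
  ~-renameˡ □ (` z) (ident _) = _ , cong `_ (sym (□ .commute z)) , ident z
  ~-renameˡ □ (ƛ A M) (ƛ p)
    with _ , refl , p′ ← ~-renameˡ (ext-square □) M p = _ , refl , ƛ p′
  ~-renameˡ □ (M · N) (p · q)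
    with _ , refl , p′ ← ~-renameˡ □ M p | _ , refl , q′ ← ~-renameˡ □ N q = _ , refl , p′ · q′
  ~-renameˡ □ (new M) (new p)
    with _ , refl , p′ ← ~-renameˡ (ext-square □) M p = _ , refl , new p′
  ~-renameˡ □ (mkvar M N) (mkvar p q)
    with _ , refl , p′ ← ~-renameˡ □ M p | _ , refl , q′ ← ~-renameˡ □ N q = _ , refl , mkvar p′ q′
  ~-renameˡ □ random random = _ , refl , random
  ~-renameˡ {x = x} □ random (drawn refl) = draw x , cong draw (sym (□ .point)) , drawn refl

  drawn-rename : ∀ {n m x y} {ρ : Fin n → Fin m} {ρ′} → Square x y ρ ρ′ →
                 ∀ M′ → rename ρ′ M′ ≡ draw y → M′ ≡ draw x
  drawn-rename {x = x} □ M′ e =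
    rename-injective (□ .injective) M′ (draw x) (trans e (cong draw (sym (□ .point))))

  -- Only `x` has no counterpart on the left, and `ρ′` sends it to `y`, which `punchIn y` never
  -- hits.
  ident-rename : ∀ {n m x y} {ρ : Fin n → Fin m} {ρ′} → Square x y ρ ρ′ →
                 ∀ w z → ρ′ z ≡ punchIn y w → ∃ λ v → w ≡ ρ v × ` v ~[ x ] ` z
  ident-rename {x = x} {y} {ρ′ = ρ′} □ w z e with x ≟ z
  ... | yes refl = contradiction (trans (sym e) (□ .point)) (punchInᵢ≢i y w)
  ... | no x≢z   = v , w≡ρv , transport (λ u → ` v ~[ x ] ` u) v≡z (ident v)
    where
    v   = punchOut x≢z
    v≡z = punchIn-punchOut x≢z
    w≡ρv = punchIn-injective y _ _ (trans (sym e) (trans (sym (cong ρ′ v≡z)) (□ .commute v)))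

  -- The counterpart of `~-renameˡ` for the backward simulation. `Q` is tied to the renamed term by
  -- an equation, as `rename ρ′ M′` could not be unified with the indices of the relation. In the
  -- case `drawn`, injectivity of `ρ′` shows that `M′` was itself a draw.
  ~-renameʳ : ∀ {n m x y} {ρ : Fin n → Fin m} {ρ′} → Square x y ρ ρ′ →
              ∀ M′ {P Q} → Q ≡ rename ρ′ M′ → P ~[ y ] Q → ∃ λ M → P ≡ rename ρ M × M ~[ x ] M′
  ~-renameʳ □ M′ e (drawn e′) with refl ← drawn-rename □ M′ (trans (sym e) e′) =
    random , refl , drawn refl
  ~-renameʳ □ (num i) refl num = num i , refl , num
  ~-renameʳ □ (op o M N) refl (op p q)
    with _ , refl , p′ ← ~-renameʳ □ M refl p | _ , refl , q′ ← ~-renameʳ □ N refl q = _ , refl , op p′ q′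
  ~-renameʳ □ skip refl skip = skip , refl , skip
  ~-renameʳ □ (M ⨾ N) refl (p ⨾ q)
    with _ , refl , p′ ← ~-renameʳ □ M refl p | _ , refl , q′ ← ~-renameʳ □ N refl q = _ , refl , p′ ⨾ q′
  ~-renameʳ □ (M := N) refl (p := q)
    with _ , refl , p′ ← ~-renameʳ □ M refl p | _ , refl , q′ ← ~-renameʳ □ N refl q = _ , refl , p′ := q′
  ~-renameʳ □ (! M) refl (! p)
    with _ , refl , p′ ← ~-renameʳ □ M refl p = _ , refl , ! p′
  ~-renameʳ □ (while M N) refl (while p q)
    with _ , refl , p′ ← ~-renameʳ □ M refl p | _ , refl , q′ ← ~-renameʳ □ N refl q = _ , refl , while p′ q′
  ~-renameʳ □ (ifzero L M N) refl (ifzero o p q)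
    with _ , refl , o′ ← ~-renameʳ □ L refl o
       | _ , refl , p′ ← ~-renameʳ □ M refl p | _ , refl , q′ ← ~-renameʳ □ N refl q = _ , refl , ifzero o′ p′ q′
  ~-renameʳ □ (` z) e (ident w) with split e
    where
    split : ∀ {n} {x y : Fin n} → ` x ≡ ` y → x ≡ y
    split refl = refl
  ... | e₁ with v , refl , r ← ident-rename □ w z (sym e₁) = ` v , refl , r
  ~-renameʳ □ (ƛ A M) refl (ƛ p)
    with _ , refl , p′ ← ~-renameʳ (ext-square □) M refl p = _ , refl , ƛ p′
  ~-renameʳ □ (M · N) refl (p · q)
    with _ , refl , p′ ← ~-renameʳ □ M refl p | _ , refl , q′ ← ~-renameʳ □ N refl q = _ , refl , p′ · q′
  ~-renameʳ □ (new M) refl (new p)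
    with _ , refl , p′ ← ~-renameʳ (ext-square □) M refl p = _ , refl , new p′
  ~-renameʳ □ (mkvar M N) refl (mkvar p q)
    with _ , refl , p′ ← ~-renameʳ □ M refl p | _ , refl , q′ ← ~-renameʳ □ N refl q = _ , refl , mkvar p′ q′
  ~-renameʳ □ random refl random = random , refl , random

  -- Simulation of evaluations

  ~-value : ∀ {n} {x : Fin (suc n)} {V V′} → Value V → V ~[ x ] V′ → Value V′
  ~-value num   num       = num
  ~-value skip  skip      = skip
  ~-value ident (ident _) = ident
  ~-value lam   (ƛ _)     = lam
  ~-value mkvar (mkvar _ _) = mkvar

  ~-value⁻ : ∀ {n} {x : Fin (suc n)} {V V′} → Value V′ → V ~[ x ] V′ → Value V
  ~-value⁻ num   num       = num
  ~-value⁻ skip  skip      = skip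
  ~-value⁻ ident (ident _) = ident
  ~-value⁻ lam   (ƛ _)     = lam
  ~-value⁻ mkvar (mkvar _ _) = mkvar
  ~-value⁻ num   (drawn ())

  -- The final content of x is chosen before the initial one, so that each draw
  -- can put its outcome in front of an already known sequence.
  ~-forward : ∀ {n} {x : Fin (suc n)} {σ τ M V M′} → ⟨ σ , M ⟩⇓⟨ τ , V ⟩ → M ~[ x ] M′ →
              ∃ λ V′ → V ~[ x ] V′ ×
              ∀ r → ∃ λ r₀ → ⟨ insertAt σ x (just r₀) , M′ ⟩⇓⟨ insertAt τ x (just r) , V′ ⟩
  ~-forward (⇓value v) p = _ , p , λ r → r , ⇓value (~-value v p)
  ~-forward (⇓app d e) (p · q)
    with _ , ƛ p′ , f ← ~-forward d p
    with _ , r′ , g ← ~-forward e (~-[] p′ q)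
    = _ , r′ , λ r → let r₁ , e′ = g r ; r₀ , d′ = f r₁ in r₀ , ⇓app d′ e′
  ~-forward (⇓op d e) (op p q)
    with _ , num , f ← ~-forward d p | _ , num , g ← ~-forward e q
    = _ , num , λ r → let r₁ , e′ = g r ; r₀ , d′ = f r₁ in r₀ , ⇓op d′ e′
  ~-forward {x = x} (⇓assign {σ″ = σ″} {x = y} d e) (p := q)
    with _ , num , f ← ~-forward d q | _ , ident _ , g ← ~-forward e p
    = _ , skip , λ r → let r₁ , e′ = g r ; r₀ , d′ = f r₁ in
      r₀ , transport (λ ς → ⟨ _ , _ ⟩⇓⟨ ς , _ ⟩) (insertAt-punchIn-update σ″ x y) (⇓assign d′ e′)
  ~-forward {x = x} (⇓deref {σ′ = σ′} {x = y} d l) (! p)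
    with _ , ident _ , f ← ~-forward d p
    = _ , num , λ r → let r₀ , d′ = f r in r₀ , ⇓deref d′ (trans (insertAt-punchIn σ′ x _ y) l)
  ~-forward (⇓seq d e) (p ⨾ q)
    with _ , skip , f ← ~-forward d p | _ , r′ , g ← ~-forward e q
    = _ , r′ , λ r → let r₁ , e′ = g r ; r₀ , d′ = f r₁ in r₀ , ⇓seq d′ e′
  ~-forward (⇓while-≢0 d i≢0) (while p q)
    with _ , num , f ← ~-forward d p
    = _ , skip , λ r → let r₀ , d′ = f r in r₀ , ⇓while-≢0 d′ i≢0
  ~-forward (⇓while-0 c d e) (while p q)
    with _ , num , f ← ~-forward c p | _ , skip , g ← ~-forward d q
       | _ , skip , h ← ~-forward e (while p q)
    = _ , skip , λ r → let r₂ , e′ = h r ; r₁ , d′ = g r₂ ; r₀ , c′ = f r₁ in r₀ , ⇓while-0 c′ d′ e′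
  ~-forward (⇓ifzero-0 d e) (ifzero o p q)
    with _ , num , f ← ~-forward d o | _ , r′ , g ← ~-forward e p
    = _ , r′ , λ r → let r₁ , e′ = g r ; r₀ , d′ = f r₁ in r₀ , ⇓ifzero-0 d′ e′
  ~-forward (⇓ifzero-≢0 d i≢0 e) (ifzero o p q)
    with _ , num , f ← ~-forward d o | _ , r′ , g ← ~-forward e q
    = _ , r′ , λ r → let r₁ , e′ = g r ; r₀ , d′ = f r₁ in r₀ , ⇓ifzero-≢0 d′ i≢0 e′
  ~-forward (⇓new {V = V} d) (new p)
    with _ , p′ , f ← ~-forward d p
    with _ , refl , q ← ~-renameˡ suc-square V p′
    = _ , q , λ r → let r₀ , d′ = f r in r₀ , ⇓new d′
  ~-forward (⇓assign-mkvar c d e) (p := q)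
    with _ , num , f ← ~-forward c q | _ , mkvar p₁ p₂ , g ← ~-forward d p
    with _ , r′ , h ← ~-forward e (p₁ · num)
    = _ , r′ , λ r → let r₂ , e′ = h r ; r₁ , d′ = g r₂ ; r₀ , c′ = f r₁ in r₀ , ⇓assign-mkvar c′ d′ e′
  ~-forward (⇓deref-mkvar d e) (! p)
    with _ , mkvar p₁ p₂ , f ← ~-forward d p
    with _ , r′ , g ← ~-forward e p₂
    = _ , r′ , λ r → let r₁ , e′ = g r ; r₀ , d′ = f r₁ in r₀ , ⇓deref-mkvar d′ e′
  ~-forward (⇓random i) random = _ , num , λ r → r , ⇓random i
  ~-forward {x = x} {σ} (⇓random i) (drawn refl) = _ , num , ⇓draw σ x i

  -- Every draw is answered by `⇓random` with the number it happened to return, so the content of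
  -- `x` is unconstrained throughout. The final store is found along the way: its shape
  -- `insertAt τ x (just r′)` belongs to the conclusion.
  ~-backward : ∀ {n} (x : Fin (suc n)) (σ : Store n) {τ′ r M′ V′ M} →
               ⟨ insertAt σ x (just r) , M′ ⟩⇓⟨ τ′ , V′ ⟩ → M ~[ x ] M′ →
               ∃ λ τ → ∃ λ r′ → ∃ λ V → τ′ ≡ insertAt τ x (just r′) × V ~[ x ] V′ × ⟨ σ , M ⟩⇓⟨ τ , V ⟩
  ~-backward x σ d (drawn refl)
    with _ , i , refl , refl ← draw-inversion σ x d = _ , _ , _ , refl , num , ⇓random i
  ~-backward x σ (⇓value v) p = _ , _ , _ , refl , p , ⇓value (~-value⁻ v p)
  ~-backward x σ (⇓app d e) (p · q)
    with σ₁ , _ , _ , refl , ƛ p′ , d′ ← ~-backward x σ d p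
    with _ , _ , _ , refl , r′ , e′ ← ~-backward x σ₁ e (~-[] p′ q)
    = _ , _ , _ , refl , r′ , ⇓app d′ e′
  ~-backward x σ (⇓op d e) (op p q)
    with σ₁ , _ , _ , refl , num , d′ ← ~-backward x σ d p
    with _ , _ , _ , refl , num , e′ ← ~-backward x σ₁ e q
    = _ , _ , _ , refl , num , ⇓op d′ e′
  ~-backward x σ (⇓assign d e) (p := q)
    with σ₁ , _ , _ , refl , num , d′ ← ~-backward x σ d q
    with σ₂ , _ , _ , refl , ident y , e′ ← ~-backward x σ₁ e p
    = _ , _ , _ , insertAt-punchIn-update σ₂ x y , skip , ⇓assign d′ e′
  ~-backward x σ (⇓deref d l) (! p)
    with σ₁ , _ , _ , refl , ident y , d′ ← ~-backward x σ d p
    = _ , _ , _ , refl , num , ⇓deref d′ (trans (sym (insertAt-punchIn σ₁ x _ y)) l)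
  ~-backward x σ (⇓seq d e) (p ⨾ q)
    with σ₁ , _ , _ , refl , skip , d′ ← ~-backward x σ d p
    with _ , _ , _ , refl , r′ , e′ ← ~-backward x σ₁ e q
    = _ , _ , _ , refl , r′ , ⇓seq d′ e′
  ~-backward x σ (⇓while-≢0 d i≢0) (while p q)
    with _ , _ , _ , refl , num , d′ ← ~-backward x σ d p
    = _ , _ , _ , refl , skip , ⇓while-≢0 d′ i≢0
  ~-backward x σ (⇓while-0 c d e) (while p q)
    with σ₁ , _ , _ , refl , num , c′ ← ~-backward x σ c p
    with σ₂ , _ , _ , refl , skip , d′ ← ~-backward x σ₁ d q
    with _ , _ , _ , refl , skip , e′ ← ~-backward x σ₂ e (while p q)
    = _ , _ , _ , refl , skip , ⇓while-0 c′ d′ e′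
  ~-backward x σ (⇓ifzero-0 d e) (ifzero o p q)
    with σ₁ , _ , _ , refl , num , d′ ← ~-backward x σ d o
    with _ , _ , _ , refl , r′ , e′ ← ~-backward x σ₁ e p
    = _ , _ , _ , refl , r′ , ⇓ifzero-0 d′ e′
  ~-backward x σ (⇓ifzero-≢0 d i≢0 e) (ifzero o p q)
    with σ₁ , _ , _ , refl , num , d′ ← ~-backward x σ d o
    with _ , _ , _ , refl , r′ , e′ ← ~-backward x σ₁ e q
    = _ , _ , _ , refl , r′ , ⇓ifzero-≢0 d′ i≢0 e′
  ~-backward x σ (⇓new {V = V} d) (new p)
    -- Exposing the head of the final store lets `insertAt` at `suc x` reduce, which identifies that
    -- head with the cell of the local variable.
    with _ ∷ _ , _ , _ , refl , p′ , d′ ← ~-backward (suc x) (just 0 ∷ σ) d p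
    with _ , refl , q ← ~-renameʳ suc-square V refl p′
    = _ , _ , _ , refl , q , ⇓new d′
  ~-backward x σ (⇓assign-mkvar c d e) (p := q)
    with σ₁ , _ , _ , refl , num , c′ ← ~-backward x σ c q
    with σ₂ , _ , _ , refl , mkvar p₁ p₂ , d′ ← ~-backward x σ₁ d p
    with _ , _ , _ , refl , r′ , e′ ← ~-backward x σ₂ e (p₁ · num)
    = _ , _ , _ , refl , r′ , ⇓assign-mkvar c′ d′ e′
  ~-backward x σ (⇓deref-mkvar d e) (! p)
    with σ₁ , _ , _ , refl , mkvar p₁ p₂ , d′ ← ~-backward x σ d p
    with _ , _ , _ , refl , r′ , e′ ← ~-backward x σ₁ e p₂
    = _ , _ , _ , refl , r′ , ⇓deref-mkvar d′ e′
  ~-backward x σ (⇓random i) random = _ , _ , _ , refl , num , ⇓random i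

  -- Replacing occurrences of random

  randoms : ∀ {n} → Term n → ℕ
  randoms (num _)        = 0
  randoms (op _ M N)     = randoms M + randoms N
  randoms skip           = 0
  randoms (M ⨾ N)        = randoms M + randoms N
  randoms (M := N)       = randoms M + randoms N
  randoms (! M)          = randoms M
  randoms (while M N)    = randoms M + randoms N
  randoms (ifzero L M N) = randoms L + (randoms M + randoms N)
  randoms (` _)          = 0
  randoms (ƛ _ M)        = randoms M
  randoms (M · N)        = randoms M + randoms N
  randoms (new M)        = randoms M
  randoms (mkvar M N)    = randoms M + randoms N
  randoms random         = 1

  -- mark b x M replaces the first b occurrences of random in M by draws from x.
  mark : ∀ {n} → ℕ → Fin (suc n) → Term n → Term (suc n)
  mark b       x (num i)        = num i
  mark b       x (op o M N)     = op o (mark b x M) (mark (b ∸ randoms M) x N)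
  mark b       x skip           = skip
  mark b       x (M ⨾ N)        = mark b x M ⨾ mark (b ∸ randoms M) x N
  mark b       x (M := N)       = mark b x M := mark (b ∸ randoms M) x N
  mark b       x (! M)          = ! mark b x M
  mark b       x (while M N)    = while (mark b x M) (mark (b ∸ randoms M) x N)
  mark b       x (ifzero L M N) = ifzero (mark b x L) (mark (b ∸ randoms L) x M)
                                         (mark (b ∸ randoms L ∸ randoms M) x N)
  mark b       x (` y)          = ` punchIn x y
  mark b       x (ƛ A M)        = ƛ A (mark b (suc x) M)
  mark b       x (M · N)        = mark b x M · mark (b ∸ randoms M) x N
  mark b       x (new M)        = new (mark b (suc x) M)
  mark b       x (mkvar M N)    = mkvar (mark b x M) (mark (b ∸ randoms M) x N)
  mark zero    x random         = random
  mark (suc b) x random         = draw x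

  ~-mark : ∀ {n} b (x : Fin (suc n)) M → M ~[ x ] mark b x M
  ~-mark b       x (num i)        = num
  ~-mark b       x (op o M N)     = op (~-mark b x M) (~-mark _ x N)
  ~-mark b       x skip           = skip
  ~-mark b       x (M ⨾ N)        = ~-mark b x M ⨾ ~-mark _ x N
  ~-mark b       x (M := N)       = ~-mark b x M := ~-mark _ x N
  ~-mark b       x (! M)          = ! ~-mark b x M
  ~-mark b       x (while M N)    = while (~-mark b x M) (~-mark _ x N)
  ~-mark b       x (ifzero L M N) = ifzero (~-mark b x L) (~-mark _ x M) (~-mark _ x N)
  ~-mark b       x (` y)          = ident y
  ~-mark b       x (ƛ A M)        = ƛ (~-mark b (suc x) M)
  ~-mark b       x (M · N)        = ~-mark b x M · ~-mark _ x N
  ~-mark b       x (new M)        = new (~-mark b (suc x) M)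
  ~-mark b       x (mkvar M N)    = mkvar (~-mark b x M) (~-mark _ x N)
  ~-mark zero    x random         = random
  ~-mark (suc b) x random         = drawn refl

  -- The budget `b` is spent on `m` first and what is left, `b ∸ m`, on `n`; truncation covers both
  -- the case where `b` runs out and the case where `m` does.
  ∸-split : ∀ b m n {m′ n′} → m′ ≡ m ∸ b → n′ ≡ n ∸ (b ∸ m) → m′ + n′ ≡ m + n ∸ b
  ∸-split zero    m       n refl refl = cong (λ z → m + (n ∸ z)) (0∸n≡0 m)
  ∸-split (suc b) zero    n refl refl = refl
  ∸-split (suc b) (suc m) n refl refl = ∸-split b m n refl refl

  randoms-mark : ∀ {n} b (x : Fin (suc n)) M → randoms (mark b x M) ≡ randoms M ∸ b
  randoms-mark₂ : ∀ {n} b (x : Fin (suc n)) M N →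
    randoms (mark b x M) + randoms (mark (b ∸ randoms M) x N) ≡ randoms M + randoms N ∸ b
  randoms-mark₂ b x M N = ∸-split b (randoms M) (randoms N) (randoms-mark b x M) (randoms-mark _ x N)

  randoms-mark b       x (num i)        = sym (0∸n≡0 b)
  randoms-mark b       x (op o M N)     = randoms-mark₂ b x M N
  randoms-mark b       x skip           = sym (0∸n≡0 b)
  randoms-mark b       x (M ⨾ N)        = randoms-mark₂ b x M N
  randoms-mark b       x (M := N)       = randoms-mark₂ b x M N
  randoms-mark b       x (! M)          = randoms-mark b x M
  randoms-mark b       x (while M N)    = randoms-mark₂ b x M N
  randoms-mark b       x (ifzero L M N) =
    ∸-split b (randoms L) (randoms M + randoms N) (randoms-mark b x L) (randoms-mark₂ _ x M N)
  randoms-mark b       x (` y)          = sym (0∸n≡0 b)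
  randoms-mark b       x (ƛ A M)        = randoms-mark b (suc x) M
  randoms-mark b       x (M · N)        = randoms-mark₂ b x M N
  randoms-mark b       x (new M)        = randoms-mark b (suc x) M
  randoms-mark b       x (mkvar M N)    = randoms-mark₂ b x M N
  randoms-mark zero    x random         = refl
  randoms-mark (suc b) x random         = sym (0∸n≡0 b)

  -- Typing of marked terms

  ⊢-without-random : ∀ {n L} {Γ : Cxt n} {M A} → randoms M ≡ 0 → Γ ⊢[ L ] M ∶ A → Γ ⊢[ mk ] M ∶ A
  ⊢-without-random z ⊢var           = ⊢var
  ⊢-without-random z (⊢lam d)       = ⊢lam (⊢-without-random z d)
  ⊢-without-random z (⊢app {M = M} s d e) =
    ⊢app s (⊢-without-random (m+n≡0⇒m≡0 (randoms M) z) d) (⊢-without-random (m+n≡0⇒n≡0 (randoms M) z) e)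
  ⊢-without-random z (⊢weak l d)    = ⊢weak l (⊢-without-random z d)
  ⊢-without-random z ⊢num           = ⊢num
  ⊢-without-random z ⊢skip          = ⊢skip
  ⊢-without-random z (⊢op {M = M} d e) =
    ⊢op (⊢-without-random (m+n≡0⇒m≡0 (randoms M) z) d) (⊢-without-random (m+n≡0⇒n≡0 (randoms M) z) e)
  ⊢-without-random z (⊢seq {M = M} b d e) =
    ⊢seq b (⊢-without-random (m+n≡0⇒m≡0 (randoms M) z) d) (⊢-without-random (m+n≡0⇒n≡0 (randoms M) z) e)
  ⊢-without-random z (⊢assign {M = M} d e) =
    ⊢assign (⊢-without-random (m+n≡0⇒m≡0 (randoms M) z) d) (⊢-without-random (m+n≡0⇒n≡0 (randoms M) z) e)
  ⊢-without-random z (⊢deref d)     = ⊢deref (⊢-without-random z d)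
  ⊢-without-random z (⊢while {M = M} d e) =
    ⊢while (⊢-without-random (m+n≡0⇒m≡0 (randoms M) z) d) (⊢-without-random (m+n≡0⇒n≡0 (randoms M) z) e)
  ⊢-without-random z (⊢ifzero {M = L} {M} b c d e) =
    let z′ = m+n≡0⇒n≡0 (randoms L) z in
    ⊢ifzero b (⊢-without-random (m+n≡0⇒m≡0 (randoms L) z) c)
      (⊢-without-random (m+n≡0⇒m≡0 (randoms M) z′) d) (⊢-without-random (m+n≡0⇒n≡0 (randoms M) z′) e)
  ⊢-without-random z (⊢new g d)     = ⊢new g (⊢-without-random z d)
  ⊢-without-random z (⊢mkvar {M = M} d e) =
    ⊢mkvar (⊢-without-random (m+n≡0⇒m≡0 (randoms M) z) d) (⊢-without-random (m+n≡0⇒n≡0 (randoms M) z) e)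

  -- The split of one-entry contexts says which side of an application receives the inserted
  -- identifier, if any.
  ⊎-insertAt : ∀ {n} {Θ Γ Δ : Cxt n} {a b c} (x : Fin (suc n)) → Θ ≔ Γ ⊎ Δ →
               (a ∷ []) ≔ (b ∷ []) ⊎ (c ∷ []) → insertAt Θ x a ≔ insertAt Γ x b ⊎ insertAt Δ x c
  ⊎-insertAt zero    s           (neither []) = neither s
  ⊎-insertAt zero    s           (left [])    = left s
  ⊎-insertAt zero    s           (right [])   = right s
  ⊎-insertAt (suc x) (neither s) t            = neither (⊎-insertAt x s t)
  ⊎-insertAt (suc x) (left s)    t            = left (⊎-insertAt x s t)
  ⊎-insertAt (suc x) (right s)   t            = right (⊎-insertAt x s t)

  -- With budget b, marking a term with m occurrences of random changes nothing.
  Idle : ℕ → ℕ → Set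
  Idle b m = b ≡ 0 ⊎ m ≡ 0

  Idle-split : ∀ {b} m {n} → Idle b (m + n) → Idle b m × Idle (b ∸ m) n
  Idle-split m (inj₁ refl) = inj₁ refl , inj₁ (0∸n≡0 m)
  Idle-split m (inj₂ z)    = inj₂ (m+n≡0⇒m≡0 m z) , inj₂ (m+n≡0⇒n≡0 m z)

  ⊢-cong : ∀ {n L} {Γ Δ : Cxt n} {M A} → Γ ≡ Δ → Γ ⊢[ L ] M ∶ A → Δ ⊢[ L ] M ∶ A
  ⊢-cong refl d = d

  ⊢mark-idle : ∀ {n L} {Γ : Cxt n} {M A} b (x : Fin (suc n)) → Idle b (randoms M) →
               Γ ⊢[ L ] M ∶ A → insertAt Γ x nothing ⊢[ L ] mark b x M ∶ A
  ⊢mark-idle b x i (⊢var {x = y} {A}) =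
    ⊢-cong (trans (cong (_[ punchIn x y ]≔ just A) (sym (insertAt-∅ x))) (insertAt-punchIn-update ∅ x y)) ⊢var
  ⊢mark-idle b x i (⊢lam d) = ⊢lam (⊢mark-idle b (suc x) i d)
  ⊢mark-idle b x i (⊢app {M = M} s d e) =
    let j , k = Idle-split (randoms M) i in
    ⊢app (⊎-insertAt x s (neither [])) (⊢mark-idle b x j d) (⊢mark-idle _ x k e)
  ⊢mark-idle b x i (⊢weak {Γ = Γ} {y} l d) =
    ⊢-cong (insertAt-punchIn-update Γ x y)
      (⊢weak (trans (insertAt-punchIn Γ x nothing y) l) (⊢mark-idle b x i d))
  ⊢mark-idle b x i ⊢num  = ⊢-cong (sym (insertAt-∅ x)) ⊢num
  ⊢mark-idle b x i ⊢skip = ⊢-cong (sym (insertAt-∅ x)) ⊢skip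
  ⊢mark-idle b x i (⊢op {M = M} d e) =
    let j , k = Idle-split (randoms M) i in ⊢op (⊢mark-idle b x j d) (⊢mark-idle _ x k e)
  ⊢mark-idle b x i (⊢seq {M = M} B d e) =
    let j , k = Idle-split (randoms M) i in ⊢seq B (⊢mark-idle b x j d) (⊢mark-idle _ x k e)
  ⊢mark-idle b x i (⊢assign {M = M} d e) =
    let j , k = Idle-split (randoms M) i in ⊢assign (⊢mark-idle b x j d) (⊢mark-idle _ x k e)
  ⊢mark-idle b x i (⊢deref d) = ⊢deref (⊢mark-idle b x i d)
  ⊢mark-idle b x i (⊢while {M = M} d e) =
    let j , k = Idle-split (randoms M) i in ⊢while (⊢mark-idle b x j d) (⊢mark-idle _ x k e)
  ⊢mark-idle b x i (⊢ifzero {M = L} {M} B c d e) =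
    let j , kl = Idle-split (randoms L) i ; k , l = Idle-split (randoms M) kl in
    ⊢ifzero B (⊢mark-idle b x j c) (⊢mark-idle _ x k d) (⊢mark-idle _ x l e)
  ⊢mark-idle b x i (⊢new g d) = ⊢new g (⊢mark-idle b (suc x) i d)
  ⊢mark-idle b x i (⊢mkvar {M = M} d e) =
    let j , k = Idle-split (randoms M) i in ⊢mkvar (⊢mark-idle b x j d) (⊢mark-idle _ x k e)
  ⊢mark-idle b x (inj₁ refl) ⊢random = ⊢random

  ⊢insertAt : ∀ {n L M A B} (Γ : Cxt n) x → insertAt Γ x nothing ⊢[ L ] M ∶ A →
              insertAt Γ x (just B) ⊢[ L ] M ∶ A
  ⊢insertAt Γ x d = ⊢-cong (insertAt-update Γ x) (⊢weak (insertAt-lookup Γ x nothing) d)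

  data _⊑_ : ∀ {n} → Cxt n → Cxt n → Set where
    []   : [] ⊑ []
    keep : ∀ {n} {Γ Δ : Cxt n} {a} → Γ ⊑ Δ → (a ∷ Γ) ⊑ (a ∷ Δ)
    add  : ∀ {n} {Γ Δ : Cxt n} {A} → Γ ⊑ Δ → (nothing ∷ Γ) ⊑ (just A ∷ Δ)

  ∅⊑ : ∀ {n} (Γ : Cxt n) → ∅ ⊑ Γ
  ∅⊑ []            = []
  ∅⊑ (nothing ∷ Γ) = keep (∅⊑ Γ)
  ∅⊑ (just _ ∷ Γ)  = add (∅⊑ Γ)

  singleton⊑ : ∀ {n} (Γ : Cxt n) x {A} → lookup Γ x ≡ just A → (∅ [ x ]≔ just A) ⊑ Γ
  singleton⊑ (_ ∷ Γ)       zero    refl = keep (∅⊑ Γ)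
  singleton⊑ (nothing ∷ Γ) (suc x) l    = keep (singleton⊑ Γ x l)
  singleton⊑ (just _ ∷ Γ)  (suc x) l    = add (singleton⊑ Γ x l)

  -- The typing rule of weakening adds one identifier at a time. Abstracting over `P` lets the
  -- recursion descend into the tails of the contexts while the heads are absorbed into the
  -- predicate.
  ⊑-induction : ∀ {n} {Γ Δ : Cxt n} → Γ ⊑ Δ → (P : Cxt n → Set) →
                (∀ Θ x A → lookup Θ x ≡ nothing → P Θ → P (Θ [ x ]≔ just A)) → P Γ → P Δ
  ⊑-induction []       P step p = p
  ⊑-induction (keep s) P step p = ⊑-induction s (λ Θ → P (_ ∷ Θ)) (λ Θ x → step (_ ∷ Θ) (suc x)) p
  ⊑-induction (add s)  P step p =
    ⊑-induction s (λ Θ → P (_ ∷ Θ)) (λ Θ x → step (_ ∷ Θ) (suc x)) (step _ zero _ refl p)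

  ⊢-weaken : ∀ {n L} {Γ Δ : Cxt n} {M A} → Γ ⊑ Δ → Γ ⊢[ L ] M ∶ A → Δ ⊢[ L ] M ∶ A
  ⊢-weaken {L = L} {M = M} {A} s = ⊑-induction s (λ Θ → Θ ⊢[ L ] M ∶ A) (λ _ _ _ → ⊢weak)

  -- All rules used here share their context among the premises, so `draw` may mention `x`
  -- repeatedly; only application would separate the uses.
  ⊢draw : ∀ {n L} (Γ : Cxt n) x → lookup Γ x ≡ just var → Γ ⊢[ L ] draw x ∶ nat
  ⊢draw {L = L} Γ x l =
    ⊢new nat (⊢seq nat
      (⊢while (⊢op (⊢op one (⊢deref k)) (⊢deref x′))
              (⊢seq comm (⊢assign k (⊢op one (⊢deref k)))
                         (⊢assign x′ (⊢op (⊢deref x′) (⊢deref k)))))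
      (⊢seq nat (⊢assign x′ (⊢op (⊢deref k) (⊢deref x′)))
      (⊢seq nat (⊢assign k (⊢op (⊢deref k) (⊢deref x′)))
                (⊢deref k))))
    where
    one : just var ∷ Γ ⊢[ L ] num 1 ∶ nat
    one = ⊢-weaken (∅⊑ _) ⊢num
    k : just var ∷ Γ ⊢[ L ] ` zero ∶ var
    k = ⊢-weaken (singleton⊑ (just var ∷ Γ) zero refl) ⊢var
    x′ : just var ∷ Γ ⊢[ L ] ` suc x ∶ var
    x′ = ⊢-weaken (singleton⊑ (just var ∷ Γ) (suc x) l) ⊢var

  ∸-≤1 : ∀ {b} m → b ≤ 1 → b ∸ m ≤ 1
  ∸-≤1 {b} m = ≤-trans (m∸n≤m b m)

  -- The bound `b ≤ 1` is for application: at most one of its two sides can then receive a draw, and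
  -- the other is typed without `x`.
  ⊢mark : ∀ {n L} {Γ : Cxt n} {M A b} (x : Fin (suc n)) → b ≤ 1 →
          Γ ⊢[ L ] M ∶ A → insertAt Γ x (just var) ⊢[ L ] mark b x M ∶ A
  ⊢mark x l ⊢var = ⊢insertAt _ x (⊢mark-idle 0 x (inj₂ refl) ⊢var)
  ⊢mark x l (⊢lam d) = ⊢lam (⊢mark (suc x) l d)
  ⊢mark {b = b} x l (⊢app {M = M} s d e) with randoms M in eq
  -- If the function has no `random`, the whole budget passes to the argument. Otherwise the
  -- function uses up the budget of at most 1, and the argument is idle.
  ... | zero  = ⊢app (⊎-insertAt x s (right [])) (⊢mark-idle b x (inj₂ eq) d) (⊢mark x l e)
  ... | suc m = ⊢app (⊎-insertAt x s (left [])) (⊢mark x l d)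
                  (⊢mark-idle _ x (inj₁ (m≤n⇒m∸n≡0 (≤-trans l (s≤s z≤n)))) e)
  ⊢mark x l (⊢weak {Γ = Γ} {y} z d) =
    ⊢-cong (insertAt-punchIn-update Γ x y) (⊢weak (trans (insertAt-punchIn Γ x _ y) z) (⊢mark x l d))
  ⊢mark x l ⊢num  = ⊢insertAt _ x (⊢mark-idle 0 x (inj₂ refl) ⊢num)
  ⊢mark x l ⊢skip = ⊢insertAt _ x (⊢mark-idle 0 x (inj₂ refl) ⊢skip)
  ⊢mark x l (⊢op {M = M} d e) = ⊢op (⊢mark x l d) (⊢mark x (∸-≤1 (randoms M) l) e)
  ⊢mark x l (⊢seq {M = M} B d e) = ⊢seq B (⊢mark x l d) (⊢mark x (∸-≤1 (randoms M) l) e)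
  ⊢mark x l (⊢assign {M = M} d e) = ⊢assign (⊢mark x l d) (⊢mark x (∸-≤1 (randoms M) l) e)
  ⊢mark x l (⊢deref d) = ⊢deref (⊢mark x l d)
  ⊢mark x l (⊢while {M = M} d e) = ⊢while (⊢mark x l d) (⊢mark x (∸-≤1 (randoms M) l) e)
  ⊢mark x l (⊢ifzero {M = L} {M} B c d e) =
    let l′ = ∸-≤1 (randoms L) l in
    ⊢ifzero B (⊢mark x l c) (⊢mark x l′ d) (⊢mark x (∸-≤1 (randoms M) l′) e)
  ⊢mark x l (⊢new g d) = ⊢new g (⊢mark (suc x) l d)
  ⊢mark x l (⊢mkvar {M = M} d e) = ⊢mkvar (⊢mark x l d) (⊢mark x (∸-≤1 (randoms M) l) e)
  ⊢mark {b = zero}          x l ⊢random = ⊢random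
  ⊢mark {Γ = Γ} {b = suc _} x l ⊢random = ⊢draw _ x (insertAt-lookup Γ x _)

  randoms-rename : ∀ {n m} {Γ : Cxt n} {M A} (ρ : Fin n → Fin m) → Γ ⊢[ mk ] M ∶ A →
                   randoms (rename ρ M) ≡ 0
  randoms-rename ρ ⊢var               = refl
  randoms-rename ρ (⊢lam d)           = randoms-rename (ext ρ) d
  randoms-rename ρ (⊢app _ d e)       = cong₂ _+_ (randoms-rename ρ d) (randoms-rename ρ e)
  randoms-rename ρ (⊢weak _ d)        = randoms-rename ρ d
  randoms-rename ρ ⊢num               = refl
  randoms-rename ρ ⊢skip              = refl
  randoms-rename ρ (⊢op d e)          = cong₂ _+_ (randoms-rename ρ d) (randoms-rename ρ e)
  randoms-rename ρ (⊢seq _ d e)       = cong₂ _+_ (randoms-rename ρ d) (randoms-rename ρ e)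
  randoms-rename ρ (⊢assign d e)      = cong₂ _+_ (randoms-rename ρ d) (randoms-rename ρ e)
  randoms-rename ρ (⊢deref d)         = randoms-rename ρ d
  randoms-rename ρ (⊢while d e)       = cong₂ _+_ (randoms-rename ρ d) (randoms-rename ρ e)
  randoms-rename ρ (⊢ifzero _ c d e)  =
    cong₂ _+_ (randoms-rename ρ c) (cong₂ _+_ (randoms-rename ρ d) (randoms-rename ρ e))
  randoms-rename ρ (⊢new _ d)         = randoms-rename (ext ρ) d
  randoms-rename ρ (⊢mkvar d e)       = cong₂ _+_ (randoms-rename ρ d) (randoms-rename ρ e)

  -- Typability in `mk` excludes `random`, so whatever the budget, marking only makes room for `x`.
  rename≡mark : ∀ {n m} {Γ : Cxt n} {M A} {ρ : Fin n → Fin m} {ρ′} b x →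
                (∀ y → ρ′ y ≡ punchIn x (ρ y)) →
                Γ ⊢[ mk ] M ∶ A → rename ρ′ M ≡ mark b x (rename ρ M)
  rename≡mark b x h ⊢var             = cong `_ (h _)
  rename≡mark b x h (⊢lam d)         =
    cong (ƛ _) (rename≡mark b (suc x) (λ { zero → refl ; (suc y) → cong suc (h y) }) d)
  rename≡mark b x h (⊢app _ d e)     = cong₂ _·_ (rename≡mark b x h d) (rename≡mark _ x h e)
  rename≡mark b x h (⊢weak _ d)      = rename≡mark b x h d
  rename≡mark b x h ⊢num             = refl
  rename≡mark b x h ⊢skip            = refl
  rename≡mark b x h (⊢op d e)        = cong₂ (op _) (rename≡mark b x h d) (rename≡mark _ x h e)
  rename≡mark b x h (⊢seq _ d e)     = cong₂ _⨾_ (rename≡mark b x h d) (rename≡mark _ x h e)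
  rename≡mark b x h (⊢assign d e)    = cong₂ _:=_ (rename≡mark b x h d) (rename≡mark _ x h e)
  rename≡mark b x h (⊢deref d)       = cong !_ (rename≡mark b x h d)
  rename≡mark b x h (⊢while d e)     = cong₂ while (rename≡mark b x h d) (rename≡mark _ x h e)
  rename≡mark b x h (⊢ifzero _ c d e) =
    trans (cong (λ L → ifzero L _ _) (rename≡mark b x h c))
          (cong₂ (ifzero _) (rename≡mark _ x h d) (rename≡mark _ x h e))
  rename≡mark b x h (⊢new _ d)       =
    cong new (rename≡mark b (suc x) (λ { zero → refl ; (suc y) → cong suc (h y) }) d)
  rename≡mark b x h (⊢mkvar d e)     = cong₂ mkvar (rename≡mark b x h d) (rename≡mark _ x h e)

  -- Contexts

  randomsᶜ : ∀ {n m} → Context n m → ℕ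
  randomsᶜ (hole ρ)          = 0
  randomsᶜ (op₁ o C N)       = randomsᶜ C + randoms N
  randomsᶜ (op₂ o N C)       = randoms N + randomsᶜ C
  randomsᶜ (seq₁ C N)        = randomsᶜ C + randoms N
  randomsᶜ (seq₂ N C)        = randoms N + randomsᶜ C
  randomsᶜ (assign₁ C N)     = randomsᶜ C + randoms N
  randomsᶜ (assign₂ N C)     = randoms N + randomsᶜ C
  randomsᶜ (deref C)         = randomsᶜ C
  randomsᶜ (while₁ C N)      = randomsᶜ C + randoms N
  randomsᶜ (while₂ N C)      = randoms N + randomsᶜ C
  randomsᶜ (ifzero₁ C M N)   = randomsᶜ C + (randoms M + randoms N)
  randomsᶜ (ifzero₂ L C N)   = randoms L + (randomsᶜ C + randoms N)
  randomsᶜ (ifzero₃ L M C)   = randoms L + (randoms M + randomsᶜ C)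
  randomsᶜ (lam A C)         = randomsᶜ C
  randomsᶜ (app₁ C N)        = randomsᶜ C + randoms N
  randomsᶜ (app₂ N C)        = randoms N + randomsᶜ C
  randomsᶜ (new C)           = randomsᶜ C
  randomsᶜ (mkvar₁ C N)      = randomsᶜ C + randoms N
  randomsᶜ (mkvar₂ N C)      = randoms N + randomsᶜ C

  -- Marking acts on the context alone, without reference to a plugged term, because the same marked
  -- context must be applied to both `M` and `N`. The plugged term is renamed away from `x`.
  markᶜ : ∀ {n m} → ℕ → Fin (suc m) → Context n m → Context n (suc m)
  markᶜ b x (hole ρ)        = hole (mk↣ (punchIn-injective x _ _) ↣-∘ ρ)
  markᶜ b x (op₁ o C N)     = op₁ o (markᶜ b x C) (mark (b ∸ randomsᶜ C) x N)
  markᶜ b x (op₂ o N C)     = op₂ o (mark b x N) (markᶜ (b ∸ randoms N) x C)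
  markᶜ b x (seq₁ C N)      = seq₁ (markᶜ b x C) (mark (b ∸ randomsᶜ C) x N)
  markᶜ b x (seq₂ N C)      = seq₂ (mark b x N) (markᶜ (b ∸ randoms N) x C)
  markᶜ b x (assign₁ C N)   = assign₁ (markᶜ b x C) (mark (b ∸ randomsᶜ C) x N)
  markᶜ b x (assign₂ N C)   = assign₂ (mark b x N) (markᶜ (b ∸ randoms N) x C)
  markᶜ b x (deref C)       = deref (markᶜ b x C)
  markᶜ b x (while₁ C N)    = while₁ (markᶜ b x C) (mark (b ∸ randomsᶜ C) x N)
  markᶜ b x (while₂ N C)    = while₂ (mark b x N) (markᶜ (b ∸ randoms N) x C)
  markᶜ b x (ifzero₁ C M N) = ifzero₁ (markᶜ b x C) (mark (b ∸ randomsᶜ C) x M)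
                                      (mark (b ∸ randomsᶜ C ∸ randoms M) x N)
  markᶜ b x (ifzero₂ L C N) = ifzero₂ (mark b x L) (markᶜ (b ∸ randoms L) x C)
                                      (mark (b ∸ randoms L ∸ randomsᶜ C) x N)
  markᶜ b x (ifzero₃ L M C) = ifzero₃ (mark b x L) (mark (b ∸ randoms L) x M)
                                      (markᶜ (b ∸ randoms L ∸ randoms M) x C)
  markᶜ b x (lam A C)       = lam A (markᶜ b (suc x) C)
  markᶜ b x (app₁ C N)      = app₁ (markᶜ b x C) (mark (b ∸ randomsᶜ C) x N)
  markᶜ b x (app₂ N C)      = app₂ (mark b x N) (markᶜ (b ∸ randoms N) x C)
  markᶜ b x (new C)         = new (markᶜ b (suc x) C)
  markᶜ b x (mkvar₁ C N)    = mkvar₁ (markᶜ b x C) (mark (b ∸ randomsᶜ C) x N)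
  markᶜ b x (mkvar₂ N C)    = mkvar₂ (mark b x N) (markᶜ (b ∸ randoms N) x C)

  module _ {n} {Γ : Cxt n} {M A} (⊢M : Γ ⊢[ mk ] M ∶ A) where

    randoms-plug : ∀ {m} (C : Context n m) → randomsᶜ C ≡ randoms (plug C M)
    randoms-plug (hole ρ)        = sym (randoms-rename (Injection.to ρ) ⊢M)
    randoms-plug (op₁ o C N)     = cong (_+ randoms N) (randoms-plug C)
    randoms-plug (op₂ o N C)     = cong (randoms N +_) (randoms-plug C)
    randoms-plug (seq₁ C N)      = cong (_+ randoms N) (randoms-plug C)
    randoms-plug (seq₂ N C)      = cong (randoms N +_) (randoms-plug C)
    randoms-plug (assign₁ C N)   = cong (_+ randoms N) (randoms-plug C)
    randoms-plug (assign₂ N C)   = cong (randoms N +_) (randoms-plug C)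
    randoms-plug (deref C)       = randoms-plug C
    randoms-plug (while₁ C N)    = cong (_+ randoms N) (randoms-plug C)
    randoms-plug (while₂ N C)    = cong (randoms N +_) (randoms-plug C)
    randoms-plug (ifzero₁ C P N) = cong (_+ (randoms P + randoms N)) (randoms-plug C)
    randoms-plug (ifzero₂ L C N) = cong (λ r → randoms L + (r + randoms N)) (randoms-plug C)
    randoms-plug (ifzero₃ L P C) = cong (λ r → randoms L + (randoms P + r)) (randoms-plug C)
    randoms-plug (lam A C)       = randoms-plug C
    randoms-plug (app₁ C N)      = cong (_+ randoms N) (randoms-plug C)
    randoms-plug (app₂ N C)      = cong (randoms N +_) (randoms-plug C)
    randoms-plug (new C)         = randoms-plug C
    randoms-plug (mkvar₁ C N)    = cong (_+ randoms N) (randoms-plug C)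
    randoms-plug (mkvar₂ N C)    = cong (randoms N +_) (randoms-plug C)

    -- Budgets agree because the plugged term contains no `random`: what remains after `C` is what
    -- remains after `plug C M`. This carries the results about `mark` over to contexts.
    plug-mark : ∀ {m} b x (C : Context n m) → plug (markᶜ b x C) M ≡ mark b x (plug C M)
    plug-mark b x (hole ρ)        = rename≡mark b x (λ _ → refl) ⊢M
    plug-mark b x (op₁ o C N)     rewrite randoms-plug C = cong₂ (op o) (plug-mark b x C) refl
    plug-mark b x (op₂ o N C)     = cong (op o _) (plug-mark _ x C)
    plug-mark b x (seq₁ C N)      rewrite randoms-plug C = cong₂ _⨾_ (plug-mark b x C) refl
    plug-mark b x (seq₂ N C)      = cong (_ ⨾_) (plug-mark _ x C)
    plug-mark b x (assign₁ C N)   rewrite randoms-plug C = cong₂ _:=_ (plug-mark b x C) refl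
    plug-mark b x (assign₂ N C)   = cong (_ :=_) (plug-mark _ x C)
    plug-mark b x (deref C)       = cong !_ (plug-mark b x C)
    plug-mark b x (while₁ C N)    rewrite randoms-plug C = cong₂ while (plug-mark b x C) refl
    plug-mark b x (while₂ N C)    = cong (while _) (plug-mark _ x C)
    plug-mark b x (ifzero₁ C P N) rewrite randoms-plug C =
      cong (λ D → ifzero D (mark (b ∸ r) x P) (mark (b ∸ r ∸ randoms P) x N)) (plug-mark b x C)
      where r = randoms (plug C M)
    plug-mark b x (ifzero₂ L C N) rewrite randoms-plug C = cong₂ (ifzero _) (plug-mark _ x C) refl
    plug-mark b x (ifzero₃ L P C) = cong (ifzero _ _) (plug-mark _ x C)
    plug-mark b x (lam A C)       = cong (ƛ A) (plug-mark b (suc x) C)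
    plug-mark b x (app₁ C N)      rewrite randoms-plug C = cong₂ _·_ (plug-mark b x C) refl
    plug-mark b x (app₂ N C)      = cong (_ ·_) (plug-mark _ x C)
    plug-mark b x (new C)         = cong new (plug-mark b (suc x) C)
    plug-mark b x (mkvar₁ C N)    rewrite randoms-plug C = cong₂ mkvar (plug-mark b x C) refl
    plug-mark b x (mkvar₂ N C)    = cong (mkvar _) (plug-mark _ x C)

  data Answer {n} : Term n → Set where
    num  : ∀ {i} → Answer (num i)
    skip : Answer skip

  -- The context is described by its lookups because `∅` could not be unified with the updated
  -- context of `⊢var` or `⊢weak`; an updated entry contradicts them at once.
  ground-value : ∀ {n L} {Γ : Cxt n} {V B} → (∀ x → lookup Γ x ≡ nothing) → Value V → Ground B →
                 Γ ⊢[ L ] V ∶ B → Answer V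
  ground-value z num   g d = num
  ground-value z skip  g d = skip
  ground-value z ident g (⊢var {x = x}) with () ← trans (sym (z x)) (lookup∘update x ∅ _)
  ground-value z ident g (⊢weak {Γ = Γ} {x} _ _) with () ← trans (sym (z x)) (lookup∘update x Γ _)
  ground-value z lam   g (⊢weak {Γ = Γ} {x} _ _) with () ← trans (sym (z x)) (lookup∘update x Γ _)
  ground-value z mkvar g (⊢weak {Γ = Γ} {x} _ _) with () ← trans (sym (z x)) (lookup∘update x Γ _)

  Answer-randoms : ∀ {n} {V : Term n} → Answer V → randoms V ≡ 0
  Answer-randoms num  = refl
  Answer-randoms skip = refl

  ~-answer : ∀ {n} {x : Fin (suc n)} {V V′} → Answer V → V ~[ x ] V′ → V′ ≡ rename (punchIn x) V
  ~-answer num  num  = refl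
  ~-answer skip skip = refl

  ~-answer⁻ : ∀ {n} {x : Fin (suc n)} {V W} → Answer V → W ~[ x ] rename (punchIn x) V → W ≡ V
  ~-answer⁻ num  num        = refl
  ~-answer⁻ num  (drawn ())
  ~-answer⁻ skip skip       = refl
  ~-answer⁻ skip (drawn ())

  -- Conservativity

  -- The context `C_r`. Since `new` initialises its variable to 0, the content `r` is assigned
  -- first.
  drawFirst : ∀ {n m} → ℕ → Context n m → Context n m
  drawFirst r C = new (seq₂ (` zero := num r) (markᶜ 1 zero C))

  ⇓-initialise : ∀ {n i r} {σ : Store n} {τ M V} →
                 ⟨ just i ∷ σ , ` zero := num r ⨾ M ⟩⇓⟨ τ , V ⟩ → ⟨ just r ∷ σ , M ⟩⇓⟨ τ , V ⟩
  ⇓-initialise (⇓seq (⇓assign (⇓value _) (⇓value _)) d) = d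

  module _ {n} {Γ : Cxt n} {M A} (⊢M : Γ ⊢[ mk ] M ∶ A) where

    randoms-drawFirst : ∀ {m} r (C : Context n m) → randomsᶜ (drawFirst r C) ≡ randomsᶜ C ∸ 1
    randoms-drawFirst r C = begin
      randomsᶜ (markᶜ 1 zero C)            ≡⟨ randoms-plug ⊢M (markᶜ 1 zero C) ⟩
      randoms (plug (markᶜ 1 zero C) M)    ≡⟨ cong randoms (plug-mark ⊢M 1 zero C) ⟩
      randoms (mark 1 zero (plug C M))     ≡⟨ randoms-mark 1 zero (plug C M) ⟩
      randoms (plug C M) ∸ 1               ≡⟨ cong (_∸ 1) (sym (randoms-plug ⊢M C)) ⟩
      randomsᶜ C ∸ 1                       ∎
      where open ≡-Reasoning

    ⊢drawFirst : ∀ {m L B} r (C : Context n m) → Ground B →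
                 ∅ ⊢[ L ] plug C M ∶ B → ∅ ⊢[ L ] plug (drawFirst r C) M ∶ B
    ⊢drawFirst {L = L} r C g d = ⊢new g (⊢seq (base g)
      (⊢assign (⊢var {x = zero}) (⊢weak {x = zero} refl ⊢num))
      (transport (λ D → _ ⊢[ L ] D ∶ _) (sym (plug-mark ⊢M 1 zero C)) (⊢mark zero ≤-refl d)))
      where
      base : ∀ {B} → Ground B → Base B
      base nat  = nat
      base comm = comm

    drawFirst-complete : ∀ {m} (C : Context n m) {V} → Answer V → plug C M ⇓ V →
                         ∃ λ r → plug (drawFirst r C) M ⇓ V
    drawFirst-complete C v d
      with V′ , V~V′ , f ← ~-forward d (~-mark 1 zero (plug C M))
      with refl ← ~-answer v V~V′
      -- The final content of the variable is discarded by `new`, so 0 is an arbitrary choice.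
      with r , d′ ← f 0 =
      r , ⇓new (⇓seq (⇓assign (⇓value num) (⇓value ident))
                     (transport (λ D → ⟨ _ , D ⟩⇓⟨ _ , _ ⟩) (sym (plug-mark ⊢M 1 zero C)) d′))

    drawFirst-sound : ∀ {m} r (C : Context n m) {V} → Answer V →
                      plug (drawFirst r C) M ⇓ V → plug C M ⇓ V
    drawFirst-sound r C v (⇓new d₀)
      with d ← ⇓-initialise d₀
      with _ , _ , _ , refl , W~V , d′ ←
        ~-backward zero ∅ (transport (λ D → ⟨ _ , D ⟩⇓⟨ _ , _ ⟩) (plug-mark ⊢M 1 zero C) d)
          (~-mark 1 zero (plug C M))
      with refl ← ~-answer⁻ v W~V = d′

  module _ {n} {Γ : Cxt n} {M N A} (⊢M : Γ ⊢[ mk ] M ∶ A) (⊢N : Γ ⊢[ mk ] N ∶ A) where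

    -- Induction on the occurrences of `random` in the context. Both plugged terms are typed in
    -- `mk`, so at 0 both programs are, and the hypothesis applies.
    ≅-transfer : M ≅[ mk ] N → ∀ k {m} (C : Context n m) → randomsᶜ C ≡ k → ∀ {L B} → Ground B →
                 ∅ ⊢[ L ] plug C M ∶ B → ∅ ⊢[ L ] plug C N ∶ B →
                 ∀ {V} → Answer V → ∅ ⊢[ L ] V ∶ B → plug C M ⇓ V → plug C N ⇓ V
    ≅-transfer M≅N zero C e g ⊢CM ⊢CN v ⊢V =
      Equivalence.to (M≅N C g
        (⊢-without-random (trans (sym (randoms-plug ⊢M C)) e) ⊢CM)
        (⊢-without-random (trans (sym (randoms-plug ⊢N C)) e) ⊢CN)
        (value v) (⊢-without-random (Answer-randoms v) ⊢V))
      where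
      value : ∀ {n} {V : Term n} → Answer V → Value V
      value num  = num
      value skip = skip
    ≅-transfer M≅N (suc k) C e g ⊢CM ⊢CN v ⊢V d =
      -- The evaluation of `C[M]` determines `r`; soundness for `N` holds for any `r`, in particular
      -- for this one.
      let r , d′ = drawFirst-complete ⊢M C v d in
      drawFirst-sound ⊢N r C v
        (≅-transfer M≅N k (drawFirst r C) (trans (randoms-drawFirst ⊢M r C) (cong (_∸ 1) e)) g
          (⊢drawFirst ⊢M r C g ⊢CM) (⊢drawFirst ⊢N r C g ⊢CN) v ⊢V d′)

lemma9p2 : (𝒜 : Arithmetic) → let open SCI 𝒜 in
    ∀ {n} {Γ : Cxt n} {A : Ty} {M N : Term n} →
    Γ ⊢[ mk ] M ∶ A → Γ ⊢[ mk ] N ∶ A →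
    M ≅[ mk ] N → M ≅[ mkran ] N
lemma9p2 𝒜 ⊢M ⊢N M≅N C g ⊢CM ⊢CN v ⊢V = mk⇔
  (≅-transfer ⊢M ⊢N M≅N _ C refl g ⊢CM ⊢CN answer ⊢V)
  (≅-transfer ⊢N ⊢M (λ D g d e v w → ⇔-sym (M≅N D g e d v w)) _ C refl g ⊢CN ⊢CM answer ⊢V)
  where
  open Derandomization 𝒜
  answer = ground-value (λ x → lookup-replicate x nothing) v g ⊢V
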